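{- For integers $s\geq 1$ and $k\geq 0$ let $T_k(s):=1-2^k+3^k-\cdots+(-1)^{s-1}s^k$. (a) When $s=2t$ is even, then for all integers $m\geq 0$ we have $H_{2m}(T_k(2t))=0$ and $$H_{2m+1}(T_k(2t))=\left(-t^2\right)^{m+1}\prod_{\ell=1}^m\big(\ell^2(t^2-\ell^2)\big)^{2(m+1-\ell)},$$ and in particular, $H_{2m+1}(T_k(2t))=0$ for $m\geq t$. (b) When $s$ is odd, then for all integers $m\geq 0$ we have $$H_{2m}(T_k(s))=\frac{(-1)^m}{m!^2}\prod_{\ell=1}^m\left(\frac{\ell^2}{4}\big(s^2-(2\ell-1)^2\big)\right)^{2(m+1-\ell)},$$ $$H_{2m+1}(T_k(s))=\frac{1}{4^{m+1}}\prod_{\ell=0}^m\frac{\ell!^4}{16^\ell}\big(s^2-(2\ell+1)^2\big)^{2(m-\ell)+1},$$ and $H_{2m}(T_k(s))=0$ when $m\geq(s+1)/2$, while $H_{2m+1}(T_k(s))=0$ when $m\geq(s-1)/2$.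
   Context: For a sequence $(c_0,c_1,\ldots)$ (indexed from $k=0$), $H_n(c_k)=\det\big(c_{i+j}\big)_{0\le i,j\le n}$; here the sequence is taken in the index $k$, with $s$ fixed. $T_k(s)=\sum_{j=1}^{s}(-1)^{j-1}j^k$. Here $m!^2=(m!)^2$, $\ell!^4=(\ell!)^4$, and empty products equal $1$. -}

module Defs where

open import Algebra.Bundles using (CommutativeRing; Semiring)
open import Data.Fin.Base using (Fin; zero; suc; toℕ; punchIn)
open import Data.Integer.Base using (+_)
open import Data.Nat.Base as ℕ using (ℕ; zero; suc; _∸_)
open import Data.Rational.Base using (ℚ; 1ℚ; -_; _*_; _/_)
import Data.Rational.Properties as ℚ

module Over {a ℓ} (R : CommutativeRing a ℓ) where

  open CommutativeRing R using (Carrier; 1#; semiring) renaming (_+_ to _⊕_; _*_ to _⊗_; -_ to ⊖_)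
  open import Algebra.Definitions.RawSemiring (Semiring.rawSemiring semiring) public
    using (_^_; sum; product)

  -- Both endpoints are included; the range is empty when b < a.
  ∑ ∏ : ℕ → ℕ → (ℕ → Carrier) → Carrier
  ∑ a b f = sum     {suc b ∸ a} (λ i → f (a ℕ.+ toℕ i))
  ∏ a b f = product {suc b ∸ a} (λ i → f (a ℕ.+ toℕ i))

  infixl 10 ∑ ∏
  syntax ∑ a b (λ i → x) = ∑[ i ∈ a ⋯ b ] x
  syntax ∏ a b (λ i → x) = ∏[ i ∈ a ⋯ b ] x

  -- Laplace expansion along the top row.
  det : ∀ {n} → (Fin n → Fin n → Carrier) → Carrier
  det {zero}  A = 1#
  det {suc n} A = sum λ j →
    ((⊖ 1#) ^ toℕ j) ⊗ (A zero j ⊗ det (λ p q → A (suc p) (punchIn j q)))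

  -- Indices run over 0 ≤ i, j ≤ n, so the matrix has order n + 1.
  H : ℕ → (ℕ → Carrier) → Carrier
  H n c = det {suc n} (λ i j → c (toℕ i ℕ.+ toℕ j))

open Over ℚ.+-*-commutativeRing public

ι : ℕ → ℚ
ι n = (+ n) / 1

-- Integer-valued, but taken in ℚ, where the determinant evaluations live.
T : ℕ → ℕ → ℚ
T k s = ∑[ j ∈ 1 ⋯ s ] (((- 1ℚ) ^ (j ∸ 1)) * (ι j ^ k))

{-# OPTIONS --safe #-}

-- T k s is the k-th moment of the functional L f = Σⱼ (-1)^(j-1) f(j) on the points 1, …, s, and
-- row operations replace the rows L(xⁱ xʲ) of the Hankel matrix by L(φᵢ xʲ) for any monic φᵢ of
-- degree i. The φᵢ are built from continuous dual Hahn polynomials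
--   P₀ = 1,  Qₘ = Pₘ + m² Qₘ₋₁,  Pₘ₊₁ = v Qₘ + Aₘ Pₘ
-- in a quadratic v of the centred variable: φ₂ₘ = Pₘ, while φ₂ₘ₊₁ is a linear factor times Qₘ
-- (s odd) or Pₘ (s even). Up to a weight u with N f = L(u f), the functional has product values
-- on a factorial basis eₖ, by telescoping, and so has N(Pₘ eₖ), which vanishes for k < m; the other
-- moments vanish by the reflection x ↦ s + 1 - x. Hence the transformed matrix is triangular for
-- s odd, and block triangular with 2 × 2 diagonal blocks [0 g; g *] for s even.
module Submission where

open import Level using (Level; _⊔_)
open import Algebra.Bundles using (CommutativeRing)
open import Data.Fin.Base using (Fin; zero; suc; toℕ; punchIn; pinch)
open import Data.Nat.Base as ℕ using (ℕ; zero; suc; _≥_; _∸_; _!)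
import Data.Nat.Properties as ℕ
open import Data.Product.Base using (Σ-syntax; ∃-syntax; _×_; _,_; proj₁; proj₂)
open import Relation.Binary.PropositionalEquality as ≡ using (_≡_)
import Data.Rational.Properties as ℚ
open import Defs using (module Over)

-- Determinants over a commutative ring

-- The product formula for N(Pₘ eₖ) is finally used only at k = 0, where it gives the first column;
-- general k is carried because v sends eₖ to a combination of eₖ and eₖ₊₁. All further zeros spread
-- from column to column by the recurrences for multiplication by x. The parity of s decides the
-- shape. Reflection x ↦ s + 1 - x preserves the functional for s odd, so the φₙ form a symmetric
-- orthogonal sequence. For s even it changes the sign: already H₀ = 0, no triangular form with
-- nonzero diagonal exists, and the weight 2z - 1, itself odd under the reflection, restores a
-- symmetric functional on polynomials in v. Polynomials occur only through their values at the
-- points and the resulting rows of moments. Multiplication by x is then a shift of columns, which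
-- in a Hankel matrix is also a shift of rows, and monicity is a statement about rows. The numbers
-- Aₘ appear as ratios of values of N and again as recurrence coefficients; one of them vanishes at
-- the index tied to the end points, which gives the vanishing for large m.

module Determinant {a ℓ} (R : CommutativeRing a ℓ) where

  open CommutativeRing R hiding (zero)
  open Over R
  open import Algebra.Properties.Ring ring
  open import Algebra.Properties.CommutativeSemigroup *-commutativeSemigroup using (x∙yz≈y∙xz)
  open import Algebra.Properties.CommutativeMonoid.Sum +-commutativeMonoid using (sum-cong-≋; ∑-distrib-+; sum-replicate-zero)
  open import Algebra.Properties.Semiring.Sum semiring using (*-distribˡ-sum)
  open import Relation.Binary.Reasoning.Setoid setoid

  sgn : ∀ {n} → Fin n → Carrier
  sgn j = (- 1#) ^ toℕ j

  Matrix : ℕ → Set a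
  Matrix n = Fin n → Fin n → Carrier

  private
    variable
      n : ℕ

  -- Opaque copies: the arguments of sum and det cannot be inferred, because
  -- both unfold at suc n.
  opaque
    Sum : (Fin n → Carrier) → Carrier
    Sum = sum

    Det : Matrix n → Carrier
    Det = det

    Det≈det : (A : Matrix n) → Det A ≈ det A
    Det≈det A = refl

    Sum-suc : (f : Fin (suc n) → Carrier) → Sum f ≈ f zero + Sum (λ j → f (suc j))
    Sum-suc f = refl

    Sum-cong : {f g : Fin n → Carrier} → (∀ j → f j ≈ g j) → Sum f ≈ Sum g
    Sum-cong = sum-cong-≋

    Sum-+ : (f g : Fin n → Carrier) → Sum (λ j → f j + g j) ≈ Sum f + Sum g
    Sum-+ = ∑-distrib-+

    *-Sum : ∀ c (f : Fin n → Carrier) → c * Sum f ≈ Sum (λ j → c * f j)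
    *-Sum = *-distribˡ-sum

    Sum-zero : {f : Fin n → Carrier} → (∀ j → f j ≈ 0#) → Sum f ≈ 0#
    Sum-zero {n} f≈0 = trans (sum-cong-≋ f≈0) (sum-replicate-zero n)

    Det-zero : (A : Matrix zero) → Det A ≈ 1#
    Det-zero A = refl

    Det-suc : (A : Matrix (suc n)) →
      Det A ≈ Sum (λ j → sgn j * (A zero j * Det (λ p q → A (suc p) (punchIn j q))))
    Det-suc A = refl

  Sum-neg : (f : Fin n → Carrier) → - Sum f ≈ Sum (λ j → - f j)
  Sum-neg f = begin
    - Sum f                    ≈⟨ -1*x≈-x _ ⟨
    - 1# * Sum f               ≈⟨ *-Sum _ f ⟩
    Sum (λ j → - 1# * f j)     ≈⟨ Sum-cong (λ j → -1*x≈-x (f j)) ⟩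
    Sum (λ j → - f j)          ∎

  sgn-suc : (j : Fin n) → ∀ x → sgn (suc j) * x ≈ - (sgn j * x)
  sgn-suc j x = trans (*-assoc _ _ x) (-1*x≈-x _)

  Det-cong : {A B : Fin n → Fin n → Carrier} → (∀ i j → A i j ≈ B i j) → Det A ≈ Det B
  Det-cong {zero}  A≈B = trans (Det-zero _) (sym (Det-zero _))
  Det-cong {suc n} A≈B = trans (Det-suc _) (trans
    (Sum-cong λ j → *-congˡ (*-cong (A≈B zero j) (Det-cong λ p q → A≈B (suc p) (punchIn j q))))
    (sym (Det-suc _)))

  -- (j , q) and (punchIn j q , pinch q j) pick out the same two elements j and
  -- punchIn j q in opposite orders, and carry opposite signs.
  Sum-sgn-symmetric : (f : Fin (suc n) → Fin n → Carrier) →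
    (∀ j q → f j q ≈ f (punchIn j q) (pinch q j)) →
    Sum (λ j → sgn j * Sum (λ q → sgn q * f j q)) ≈ 0#
  Sum-sgn-symmetric {zero} f f-sym =
    Sum-zero λ j → trans (*-congˡ (Sum-zero λ ())) (zeroʳ _)
  Sum-sgn-symmetric {suc n} f f-sym = begin
    Sum (λ j → sgn j * Sum (λ q → sgn q * f j q))
      ≈⟨ Sum-suc _ ⟩
    1# * S + Sum (λ j → sgn (suc j) * Sum (λ q → sgn q * f (suc j) q))
      ≈⟨ +-cong (*-identityˡ S) (trans (Sum-cong split) (Sum-+ _ _)) ⟩
    S + (Sum (λ j → - (sgn j * f zero j)) + Sum (λ j → sgn j * Sum (λ q → sgn q * g j q)))
      ≈⟨ +-congˡ (+-cong (Sum-neg _) refl) ⟨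
    S + (- S + Sum (λ j → sgn j * Sum (λ q → sgn q * g j q)))
      ≈⟨ +-congˡ (+-congˡ (Sum-sgn-symmetric g (λ j q → f-sym (suc j) (suc q)))) ⟩
    S + (- S + 0#)
      ≈⟨ +-congˡ (+-identityʳ _) ⟩
    S + - S
      ≈⟨ -‿inverseʳ S ⟩
    0# ∎
    where
    g : Fin (suc n) → Fin n → Carrier
    g j q = f (suc j) (suc q)
    S : Carrier
    S = Sum (λ q → sgn q * f zero q)
    split : ∀ j → sgn (suc j) * Sum (λ q → sgn q * f (suc j) q)
                ≈ - (sgn j * f zero j) + sgn j * Sum (λ q → sgn q * g j q)
    split j = begin
      sgn (suc j) * Sum (λ q → sgn q * f (suc j) q)
        ≈⟨ *-congˡ (Sum-suc _) ⟩
      sgn (suc j) * (1# * f (suc j) zero + Sum (λ q → sgn (suc q) * g j q))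
        ≈⟨ *-congˡ (+-cong (trans (*-identityˡ _) (f-sym (suc j) zero))
             (trans (Sum-cong (λ q → sgn-suc q _)) (sym (Sum-neg _)))) ⟩
      sgn (suc j) * (f zero j + - Sum (λ q → sgn q * g j q))
        ≈⟨ sgn-suc j _ ⟩
      - (sgn j * (f zero j + - Sum (λ q → sgn q * g j q)))
        ≈⟨ -‿cong (distribˡ _ _ _) ⟩
      - (sgn j * f zero j + sgn j * - Sum (λ q → sgn q * g j q))
        ≈⟨ -‿+-comm _ _ ⟨
      - (sgn j * f zero j) + - (sgn j * - Sum (λ q → sgn q * g j q))
        ≈⟨ +-congˡ (trans (-‿cong (sym (-‿distribʳ-* _ _))) (-‿involutive _)) ⟩
      - (sgn j * f zero j) + sgn j * Sum (λ q → sgn q * g j q) ∎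

  punchIn-pinch : (j : Fin (suc n)) (q : Fin n) → punchIn (punchIn j q) (pinch q j) ≡ j
  punchIn-pinch {suc n} zero    q       = ≡.refl
  punchIn-pinch         (suc j) zero    = ≡.refl
  punchIn-pinch         (suc j) (suc q) = ≡.cong suc (punchIn-pinch j q)

  -- Deleting two columns in either order leaves the same columns in the same increasing order, so
  -- second-order minors are symmetric in the chosen pair without a sign.
  punchIn-swap : (j : Fin (suc (suc n))) (q : Fin (suc n)) (r : Fin n) →
    punchIn j (punchIn q r) ≡ punchIn (punchIn j q) (punchIn (pinch q j) r)
  punchIn-swap zero    q       r       = ≡.refl
  punchIn-swap (suc j) zero    r       = ≡.refl
  punchIn-swap (suc j) (suc q) zero    = ≡.refl
  punchIn-swap (suc j) (suc q) (suc r) = ≡.cong suc (punchIn-swap j q r)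

  -- Double expansion, row exchange and shear

  expand₂ : (Fin (suc (suc n)) → Fin (suc n) → Carrier) → Carrier
  expand₂ f = Sum (λ j → sgn j * Sum (λ q → sgn q * f j q))

  minor₂ : Matrix (suc (suc n)) → Fin (suc (suc n)) → Fin (suc n) → Carrier
  minor₂ A j q = Det (λ p r → A (suc (suc p)) (punchIn j (punchIn q r)))

  minor₂-sym : (A : Matrix (suc (suc n))) → ∀ j q → minor₂ A j q ≈ minor₂ A (punchIn j q) (pinch q j)
  minor₂-sym A j q = Det-cong λ p r → reflexive (≡.cong (A (suc (suc p))) (punchIn-swap j q r))

  Det-expand₂ : (A : Matrix (suc (suc n))) →
    Det A ≈ expand₂ (λ j q → (A zero j * A (suc zero) (punchIn j q)) * minor₂ A j q)
  Det-expand₂ A = trans (Det-suc A) (Sum-cong λ j → *-congˡ (trans (*-congˡ (Det-suc _))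
    (trans (*-Sum _ _) (Sum-cong λ q →
      trans (x∙yz≈y∙xz _ _ _) (*-congˡ (sym (*-assoc _ _ _)))))))

  Det-equal-rows : (A : Matrix (suc (suc n))) → (∀ j → A zero j ≈ A (suc zero) j) → Det A ≈ 0#
  Det-equal-rows A eq = trans (Det-expand₂ A) (Sum-sgn-symmetric _ λ j q →
    *-cong (begin
      A zero j * A (suc zero) (punchIn j q)                            ≈⟨ *-cong (eq j) (sym (eq _)) ⟩
      A (suc zero) j * A zero (punchIn j q)                            ≈⟨ *-comm _ _ ⟩
      A zero (punchIn j q) * A (suc zero) j
        ≈⟨ *-congˡ (reflexive (≡.cong (A (suc zero)) (punchIn-pinch j q))) ⟨
      A zero (punchIn j q) * A (suc zero) (punchIn (punchIn j q) (pinch q j)) ∎)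
    (minor₂-sym A j q))

  -- The double expansion of `Det A` has the coefficients of `Det B` with the two chosen columns
  -- exchanged. Their sum is therefore symmetric and cancels.
  Det-swap : {A B : Matrix (suc (suc n))} →
    (∀ j → A zero j ≈ B (suc zero) j) → (∀ j → A (suc zero) j ≈ B zero j) →
    (∀ i j → A (suc (suc i)) j ≈ B (suc (suc i)) j) → Det A ≈ - Det B
  Det-swap {n} {A} {B} eq₀ eq₁ eq = begin
    Det A                 ≈⟨ +-identityʳ _ ⟨
    Det A + 0#            ≈⟨ +-congˡ (-‿inverseʳ _) ⟨
    Det A + (Det B - Det B) ≈⟨ +-assoc _ _ _ ⟨
    (Det A + Det B) - Det B ≈⟨ +-congʳ A+B≈0 ⟩
    0# - Det B            ≈⟨ +-identityˡ _ ⟩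
    - Det B               ∎
    where
    f : Fin (suc (suc n)) → Fin (suc n) → Carrier
    f j q = (B (suc zero) j * B zero (punchIn j q) + B zero j * B (suc zero) (punchIn j q)) * minor₂ B j q
    f-sym : ∀ j q → f j q ≈ f (punchIn j q) (pinch q j)
    f-sym j q = *-cong (begin
      B (suc zero) j * B zero (punchIn j q) + B zero j * B (suc zero) (punchIn j q)
        ≈⟨ +-comm _ _ ⟩
      B zero j * B (suc zero) (punchIn j q) + B (suc zero) j * B zero (punchIn j q)
        ≈⟨ +-cong (trans (*-comm _ _) (*-congˡ (back zero))) (trans (*-comm _ _) (*-congˡ (back (suc zero)))) ⟩
      B (suc zero) (punchIn j q) * B zero (punchIn (punchIn j q) (pinch q j))
        + B zero (punchIn j q) * B (suc zero) (punchIn (punchIn j q) (pinch q j)) ∎)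
      (minor₂-sym B j q)
      where
      back : ∀ i → B i j ≈ B i (punchIn (punchIn j q) (pinch q j))
      back i = reflexive (≡.cong (B i) (≡.sym (punchIn-pinch j q)))
    A+B≈0 : Det A + Det B ≈ 0#
    A+B≈0 = begin
      Det A + Det B ≈⟨ +-cong (Det-expand₂ A) (Det-expand₂ B) ⟩
      expand₂ (λ j q → (A zero j * A (suc zero) (punchIn j q)) * minor₂ A j q)
        + expand₂ (λ j q → (B zero j * B (suc zero) (punchIn j q)) * minor₂ B j q)
        ≈⟨ Sum-+ _ _ ⟨
      Sum (λ j → sgn j * Sum (λ q → sgn q * ((A zero j * A (suc zero) (punchIn j q)) * minor₂ A j q))
        + sgn j * Sum (λ q → sgn q * ((B zero j * B (suc zero) (punchIn j q)) * minor₂ B j q)))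
        ≈⟨ Sum-cong (λ j → trans (sym (distribˡ _ _ _)) (*-congˡ (trans (sym (Sum-+ _ _))
             (Sum-cong λ q → trans (sym (distribˡ _ _ _)) (*-congˡ (trans (+-congʳ
               (*-cong (*-cong (eq₀ j) (eq₁ _)) (Det-cong λ p r → eq p _))) (sym (distribʳ _ _ _)))))))) ⟩
      expand₂ f ≈⟨ Sum-sgn-symmetric f f-sym ⟩
      0# ∎

  swap₀₁ : {A : Set a} → (Fin (suc (suc n)) → A) → Fin (suc (suc n)) → A
  swap₀₁ r zero          = r (suc zero)
  swap₀₁ r (suc zero)    = r zero
  swap₀₁ r (suc (suc i)) = r (suc (suc i))

  -- Expansion runs along the top row, so a sheared row is exchanged with the pivot row `B zero`.
  -- Each minor then has the pivot row on top and falls to the induction, while the multiple of the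
  -- pivot row split off from the new top row gives a determinant with two equal rows.
  Det-shear : {A B : Matrix (suc n)} (c : Fin n → Carrier) → (∀ j → A zero j ≈ B zero j) →
    (∀ i j → A (suc i) j ≈ B (suc i) j + c i * B zero j) → Det A ≈ Det B
  Det-shear {zero}  c eq₀ eq = Det-cong λ { zero j → eq₀ j ; (suc ()) }
  Det-shear {suc n} {A} {B} c eq₀ eq = begin
    Det A              ≈⟨ Det-swap (λ _ → refl) (λ _ → refl) (λ _ _ → refl) ⟩
    - Det (swap₀₁ A)   ≈⟨ -‿cong sheared ⟩
    - Det (swap₀₁ B)   ≈⟨ Det-swap (λ _ → refl) (λ _ → refl) (λ _ _ → refl) ⟨
    Det B              ∎
    where
    m : Fin (suc (suc n)) → Carrier
    m j = Det (λ p q → swap₀₁ B (suc p) (punchIn j q))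
    B₀₀ : Matrix (suc (suc n))
    B₀₀ zero    = B zero
    B₀₀ (suc i) = swap₀₁ B (suc i)
    sheared : Det (swap₀₁ A) ≈ Det (swap₀₁ B)
    sheared = begin
      Det (swap₀₁ A)
        ≈⟨ Det-suc _ ⟩
      Sum (λ j → sgn j * (A (suc zero) j * Det (λ p q → swap₀₁ A (suc p) (punchIn j q))))
        ≈⟨ Sum-cong (λ j → *-congˡ (*-cong (eq zero j) (Det-shear (λ i → c (suc i))
             (λ q → eq₀ (punchIn j q)) (λ p q → eq (suc p) (punchIn j q))))) ⟩
      Sum (λ j → sgn j * ((B (suc zero) j + c zero * B zero j) * m j))
        ≈⟨ Sum-cong (λ j → trans (*-congˡ (trans (distribʳ _ _ _) (+-congˡ (*-assoc _ _ _))))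
             (trans (distribˡ _ _ _) (+-congˡ (x∙yz≈y∙xz _ _ _)))) ⟩
      Sum (λ j → sgn j * (B (suc zero) j * m j) + c zero * (sgn j * (B zero j * m j)))
        ≈⟨ Sum-+ _ _ ⟩
      Sum (λ j → sgn j * (B (suc zero) j * m j)) + Sum (λ j → c zero * (sgn j * (B zero j * m j)))
        ≈⟨ +-cong (sym (Det-suc (swap₀₁ B)))
             (trans (sym (*-Sum (c zero) _)) (*-congˡ (sym (Det-suc B₀₀)))) ⟩
      Det (swap₀₁ B) + c zero * Det B₀₀
        ≈⟨ +-congˡ (trans (*-congˡ (Det-equal-rows B₀₀ (λ _ → refl))) (zeroʳ _)) ⟩
      Det (swap₀₁ B) + 0#
        ≈⟨ +-identityʳ _ ⟩
      Det (swap₀₁ B) ∎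

  Det-zero-column : (A : Matrix (suc n)) → (∀ i → A i zero ≈ 0#) → Det A ≈ 0#
  Det-zero-column {n} A col = trans (Det-suc A) (Sum-zero λ j → trans (*-congˡ (term n A col j)) (zeroʳ _))
    where
    term : ∀ n (A : Matrix (suc n)) → (∀ i → A i zero ≈ 0#) → ∀ j →
           A zero j * Det (λ p q → A (suc p) (punchIn j q)) ≈ 0#
    term n       A col zero    = trans (*-congʳ (col zero)) (zeroˡ _)
    term (suc n) A col (suc j) =
      trans (*-congˡ (Det-zero-column _ (λ p → col (suc p)))) (zeroʳ _)

  Det-first-column : (A : Matrix (suc n)) → (∀ i → A (suc i) zero ≈ 0#) →
    Det A ≈ A zero zero * Det (λ p q → A (suc p) (suc q))
  Det-first-column {n} A col = begin
    Det A ≈⟨ trans (Det-suc A) (trans (Sum-suc _) (+-cong (*-identityˡ _) (Sum-zero (rest n A col)))) ⟩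
    A zero zero * Det (λ p q → A (suc p) (suc q)) + 0# ≈⟨ +-identityʳ _ ⟩
    A zero zero * Det (λ p q → A (suc p) (suc q)) ∎
    where
    rest : ∀ n (A : Matrix (suc n)) → (∀ i → A (suc i) zero ≈ 0#) → ∀ j →
      sgn (suc j) * (A zero (suc j) * Det (λ p q → A (suc p) (punchIn (suc j) q))) ≈ 0#
    rest (suc n) A col j =
      trans (*-congˡ (trans (*-congˡ (Det-zero-column _ col)) (zeroʳ _))) (zeroʳ _)

  -- Monic changes of rows

  module _ {X : Set} where

    -- Rows are functions on any column set, and a combination of the first `n` of them is a list of
    -- terms up to pointwise equality. Extracting the coefficient of `r zero` is then a recursion on
    -- the list.
    data Span (r : ℕ → X → Carrier) : ℕ → (X → Carrier) → Set (a ⊔ ℓ) where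
      null : ∀ {n g} → (∀ x → g x ≈ 0#) → Span r n g
      step : ∀ {n k g h} → k ℕ.< n → (c : Carrier) → Span r n h →
             (∀ x → g x ≈ h x + c * r k x) → Span r n g

    split-first : ∀ {r n g} → Span r (suc n) g →
      Σ[ c ∈ Carrier ] Σ[ h ∈ (X → Carrier) ]
        Span (λ i → r (suc i)) n h × (∀ x → g x ≈ h x + c * r zero x)
    split-first (null g≈0) = 0# , _ , null (λ _ → refl) , λ x →
      trans (g≈0 x) (sym (trans (+-congˡ (zeroˡ _)) (+-identityˡ 0#)))
    split-first {r} (step {k = zero} k<n c s eq) with split-first s
    ... | c′ , h , s′ , eq′ = c′ + c , h , s′ , λ x → begin
      _                                       ≈⟨ eq x ⟩
      _                                       ≈⟨ +-congʳ (eq′ x) ⟩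
      (h x + c′ * r zero x) + c * r zero x    ≈⟨ +-assoc _ _ _ ⟩
      h x + (c′ * r zero x + c * r zero x)    ≈⟨ +-congˡ (distribʳ _ _ _) ⟨
      h x + (c′ + c) * r zero x               ∎
    split-first {r} (step {k = suc k} (ℕ.s≤s k<n) c s eq) with split-first s
    ... | c′ , h , s′ , eq′ = c′ , (λ x → h x + c * r (suc k) x) , step k<n c s′ (λ _ → refl) , λ x → begin
      _                                            ≈⟨ eq x ⟩
      _                                            ≈⟨ +-congʳ (eq′ x) ⟩
      (h x + c′ * r zero x) + c * r (suc k) x      ≈⟨ +-assoc _ _ _ ⟩
      h x + (c′ * r zero x + c * r (suc k) x)      ≈⟨ +-congˡ (+-comm _ _) ⟩
      h x + (c * r (suc k) x + c′ * r zero x)      ≈⟨ +-assoc _ _ _ ⟨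
      (h x + c * r (suc k) x) + c′ * r zero x      ∎

    Monic : (r : ℕ → X → Carrier) → ℕ → (X → Carrier) → Set (a ⊔ ℓ)
    Monic r n g = Σ[ h ∈ (X → Carrier) ] Span r n h × (∀ x → g x ≈ h x + r n x)

    span-empty : ∀ {r g} → Span r zero g → ∀ x → g x ≈ 0#
    span-empty (null g≈0) = g≈0

    span-mono : ∀ {r m n g} → m ℕ.≤ n → Span r m g → Span r n g
    span-mono m≤n (null g≈0)        = null g≈0
    span-mono m≤n (step k<m c s eq) = step (ℕ.≤-trans k<m m≤n) c (span-mono m≤n s) eq

    span-+* : ∀ {r n g h k} c → Span r n g → Span r n h → (∀ x → k x ≈ g x + c * h x) → Span r n k
    span-+* {g = g} {h} c (null g≈0) t eq = scale t λ x → trans (eq x) (trans (+-congʳ (g≈0 x)) (+-identityˡ _))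
      where
      scale : ∀ {r n h k} → Span r n h → (∀ x → k x ≈ c * h x) → Span r n k
      scale (null h≈0) eq = null λ x → trans (eq x) (trans (*-congˡ (h≈0 x)) (zeroʳ c))
      scale (step k<n d s eq′) eq = step k<n (c * d) (scale s (λ _ → refl)) λ x →
        trans (eq x) (trans (*-congˡ (eq′ x)) (trans (distribˡ _ _ _) (+-congˡ (sym (*-assoc _ _ _)))))
    span-+* {h = h} c (step k<n d s eq′) t eq = step k<n d (span-+* c s t (λ _ → refl)) λ x → begin
      _             ≈⟨ eq x ⟩
      _             ≈⟨ +-congʳ (eq′ x) ⟩
      _             ≈⟨ +-assoc _ _ _ ⟩
      _             ≈⟨ +-congˡ (+-comm _ _) ⟩
      _             ≈⟨ +-assoc _ _ _ ⟨
      _             ∎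

    span-monic : ∀ {r n k f g h} → k ℕ.< n → Monic r k f → ∀ c → Span r n h →
      (∀ x → g x ≈ h x + c * f x) → Span r n g
    span-monic {r} {k = k} {f} {h = h} k<n (l , s , f≈) c t eq =
      step k<n c (span-+* c t (span-mono (ℕ.<⇒≤ k<n) s) (λ _ → refl)) λ x → begin
        _                                      ≈⟨ eq x ⟩
        h x + c * f x                          ≈⟨ +-congˡ (trans (*-congˡ (f≈ x)) (distribˡ _ _ _)) ⟩
        h x + (c * l x + c * r k x)            ≈⟨ +-assoc _ _ _ ⟨
        (h x + c * l x) + c * r k x            ∎

    -- For Hankel rows, composing with the column shift `S` is multiplication by the variable, so it
    -- raises the degree by one and keeps the leading coefficient. The row `h` collects the lower
    -- terms of a recurrence.
    monic-shift : ∀ {r : ℕ → X → Carrier} (S : X → X) → (∀ k x → r k (S x) ≈ r (suc k) x) →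
      ∀ {n f g h} → Monic r n f → Span r (suc n) h → (∀ x → g x ≈ f (S x) + h x) → Monic r (suc n) g
    monic-shift {r} S r-shift {n} {f} {g} {h} (l , s , f≈) t eq =
      _ , span-+* 1# (shift s) t (λ _ → refl) , λ x → begin
        g x                                    ≈⟨ eq x ⟩
        f (S x) + h x                          ≈⟨ +-congʳ (f≈ (S x)) ⟩
        (l (S x) + r n (S x)) + h x            ≈⟨ +-assoc _ _ _ ⟩
        l (S x) + (r n (S x) + h x)            ≈⟨ +-congˡ (+-comm _ _) ⟩
        l (S x) + (h x + r n (S x))            ≈⟨ +-assoc _ _ _ ⟨
        (l (S x) + h x) + r n (S x)            ≈⟨ +-cong (+-congˡ (sym (*-identityˡ _))) (r-shift n x) ⟩
        (l (S x) + 1# * h x) + r (suc n) x     ∎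
      where
      shift : ∀ {n g} → Span r n g → Span r (suc n) (λ x → g (S x))
      shift (null g≈0)        = null (λ x → g≈0 (S x))
      shift (step k<n c s eq) = step (ℕ.s≤s k<n) c (shift s) λ x →
        trans (eq (S x)) (+-congˡ (*-congˡ (r-shift _ x)))

    -- One shear removes the `r zero` component from all later rows at once, and what remains is
    -- monic over `λ i → r (suc i)`. The choice of columns `κ` is arbitrary so that the induction
    -- covers the minors of the top row.
    Det-monic-rows : ∀ {n} {r f : ℕ → X → Carrier} → (∀ i → Monic r i (f i)) → (κ : Fin n → X) →
      Det (λ i j → f (toℕ i) (κ j)) ≈ Det (λ i j → r (toℕ i) (κ j))
    Det-monic-rows {zero}  mon κ = Det-cong λ ()
    Det-monic-rows {suc n} {r} {f} mon κ = begin
      Det (λ i j → f (toℕ i) (κ j))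
        ≈⟨ Det-shear {B = B} (λ i → c (toℕ i)) f₀≈r₀ (λ i j → f-suc (toℕ i) (κ j)) ⟩
      Det B
        ≈⟨ Det-suc B ⟩
      Sum (λ j → sgn j * (r zero (κ j) * Det (λ p q → f′ (toℕ p) (κ (punchIn j q)))))
        ≈⟨ Sum-cong (λ j → *-congˡ (*-congˡ (Det-monic-rows mon′ (λ q → κ (punchIn j q))))) ⟩
      Sum (λ j → sgn j * (r zero (κ j) * Det (λ p q → r (suc (toℕ p)) (κ (punchIn j q)))))
        ≈⟨ Det-suc _ ⟨
      Det (λ i j → r (toℕ i) (κ j)) ∎
      where
      c : ℕ → Carrier
      c i with mon (suc i)
      ... | _ , s , _ with split-first s
      ...   | d , _ = d
      f′ : ℕ → X → Carrier
      f′ i x with mon (suc i)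
      ... | _ , s , _ with split-first s
      ...   | _ , h , _ = h x + r (suc i) x
      f₀≈r₀ : ∀ j → f zero (κ j) ≈ r zero (κ j)
      f₀≈r₀ j with mon zero
      ... | _ , s , eq = trans (eq (κ j)) (trans (+-congʳ (span-empty s (κ j))) (+-identityˡ _))
      mon′ : ∀ i → Monic (λ i → r (suc i)) i (f′ i)
      mon′ i with mon (suc i)
      ... | _ , s , _ with split-first s
      ...   | _ , h , s′ , _ = h , s′ , λ _ → refl
      f-suc : ∀ i x → f (suc i) x ≈ f′ i x + c i * r zero x
      f-suc i x with mon (suc i)
      ... | _ , s , eq with split-first s
      ...   | d , h , s′ , eq′ = begin
        _                                        ≈⟨ eq x ⟩
        _                                        ≈⟨ +-congʳ (eq′ x) ⟩
        (h x + d * r zero x) + r (suc i) x       ≈⟨ +-assoc _ _ _ ⟩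
        h x + (d * r zero x + r (suc i) x)       ≈⟨ +-congˡ (+-comm _ _) ⟩
        h x + (r (suc i) x + d * r zero x)       ≈⟨ +-assoc _ _ _ ⟨
        (h x + r (suc i) x) + d * r zero x       ∎
      B : Matrix (suc n)
      B zero    j = r zero (κ j)
      B (suc i) j = f′ (toℕ i) (κ j)

  -- Only two terms of the expansion survive: each later minor retains both of the first two
  -- columns, and both have their only possibly nonzero entry in its top row.
  Det-block : (A : Matrix (suc (suc n))) →
    (∀ i → A (suc (suc i)) zero ≈ 0#) → (∀ i → A (suc (suc i)) (suc zero) ≈ 0#) →
    Det A ≈ (A zero zero * A (suc zero) (suc zero) - A zero (suc zero) * A (suc zero) zero)
            * Det (λ p q → A (suc (suc p)) (suc (suc q)))
  Det-block {n} A col₀ col₁ = begin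
    Det A
      ≈⟨ trans (Det-suc A) (trans (Sum-suc _) (+-congˡ (Sum-suc _))) ⟩
    1# * (A zero zero * Det (λ p q → A (suc p) (suc q)))
      + ((- 1# * 1#) * (A zero (suc zero) * Det (λ p q → A (suc p) (punchIn (suc zero) q)))
        + Sum (λ j → sgn (suc (suc j)) * (A zero (suc (suc j)) * Det (λ p q → A (suc p) (punchIn (suc (suc j)) q)))))
      ≈⟨ +-cong (*-identityˡ _) (trans (+-cong (trans (*-congʳ (*-identityʳ _)) (-1*x≈-x _))
           (Sum-zero (rest n A col₀ col₁))) (+-identityʳ _)) ⟩
    A zero zero * Det (λ p q → A (suc p) (suc q))
      - A zero (suc zero) * Det (λ p q → A (suc p) (punchIn (suc zero) q))
      ≈⟨ +-cong (trans (*-congˡ (Det-first-column _ col₁)) (sym (*-assoc _ _ _)))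
           (trans (-‿cong (trans (*-congˡ (Det-first-column _ col₀)) (sym (*-assoc _ _ _)))) (-‿distribˡ-* _ _)) ⟩
    (A zero zero * A (suc zero) (suc zero)) * Det (λ p q → A (suc (suc p)) (suc (suc q)))
      + - (A zero (suc zero) * A (suc zero) zero) * Det (λ p q → A (suc (suc p)) (suc (suc q)))
      ≈⟨ distribʳ _ _ _ ⟨
    (A zero zero * A (suc zero) (suc zero) - A zero (suc zero) * A (suc zero) zero)
      * Det (λ p q → A (suc (suc p)) (suc (suc q))) ∎
    where
    rest : ∀ n (A : Matrix (suc (suc n))) →
      (∀ i → A (suc (suc i)) zero ≈ 0#) → (∀ i → A (suc (suc i)) (suc zero) ≈ 0#) → ∀ j →
      sgn (suc (suc j)) * (A zero (suc (suc j)) * Det (λ p q → A (suc p) (punchIn (suc (suc j)) q))) ≈ 0#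
    rest (suc n) A col₀ col₁ j = trans (*-congˡ (trans (*-congˡ (trans (Det-first-column _ col₀)
      (trans (*-congˡ (Det-zero-column _ col₁)) (zeroʳ _)))) (zeroʳ _))) (zeroʳ _)

  -- Block triangular determinants with interleaved rows

  ∏< : (ℕ → Carrier) → ℕ → Carrier
  ∏< f zero    = 1#
  ∏< f (suc n) = ∏< f n * f n

  ∏<-front : ∀ f n → ∏< f (suc n) ≈ f zero * ∏< (λ i → f (suc i)) n
  ∏<-front f zero    = *-comm _ _
  ∏<-front f (suc n) = trans (*-congʳ (∏<-front f n)) (*-assoc _ _ _)

  interleave : {X : Set} → (ℕ → X → Carrier) → (ℕ → X → Carrier) → ℕ → X → Carrier
  interleave E O zero    = E zero
  interleave E O (suc n) = interleave O (λ m → E (suc m)) n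

  -- The motive absorbs one index while the two families exchange roles. Since `suc m ℕ.* 2` reduces
  -- to two successors, the positions agree by computation; this is why 2m is written `m ℕ.* 2`.
  interleave-elim : {X : Set} {p : Level} (P : ℕ → (X → Carrier) → Set p) {E O : ℕ → X → Carrier} →
    (∀ m → P (m ℕ.* 2) (E m)) → (∀ m → P (suc (m ℕ.* 2)) (O m)) → ∀ n → P n (interleave E O n)
  interleave-elim P pE pO zero    = pE zero
  interleave-elim P pE pO (suc n) = interleave-elim (λ m → P (suc m)) pO (λ m → pE (suc m)) n

  block : (ℕ → ℕ → Carrier) → (ℕ → ℕ → Carrier) → ℕ → Carrier
  block E O m = E m (m ℕ.* 2) * O m (suc (m ℕ.* 2)) - E m (suc (m ℕ.* 2)) * O m (m ℕ.* 2)

  private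
    shift₂ : (ℕ → ℕ → Carrier) → ℕ → ℕ → Carrier
    shift₂ E m j = E (suc m) (suc (suc j))

    matrix : ∀ n → (ℕ → ℕ → Carrier) → Matrix n
    matrix n f i j = f (toℕ i) (toℕ j)

    interleave-shift₂ : ∀ E O n j → interleave E O (suc (suc n)) (suc (suc j)) ≡ interleave (shift₂ E) (shift₂ O) n j
    interleave-shift₂ E O zero    j = ≡.refl
    interleave-shift₂ E O (suc n) j = interleave-shift₂ O (λ m → E (suc m)) n j

  -- One bound for the rows 2m and 2m + 1 alike describes block triangular form. Triangular matrices
  -- are covered too: their extra zero lies inside a block.
  Vanishing : (ℕ → ℕ → Carrier) → Set ℓ
  Vanishing E = ∀ m j → j ℕ.< m ℕ.* 2 → E m j ≈ 0#

  private
    vanishing-shift₂ : ∀ {E} → Vanishing E → Vanishing (shift₂ E)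
    vanishing-shift₂ E≈0 m j j<2m = E≈0 (suc m) (suc (suc j)) (ℕ.s≤s (ℕ.s≤s j<2m))

    interleave-vanishing : ∀ {E O} → Vanishing E → Vanishing O → ∀ n →
      interleave E O (suc (suc n)) 0 ≈ 0# × interleave E O (suc (suc n)) 1 ≈ 0#
    interleave-vanishing {E} {O} E≈0 O≈0 = interleave-elim (λ _ g → g 0 ≈ 0# × g 1 ≈ 0#) (column E≈0) (column O≈0)
      where
      column : ∀ {E} → Vanishing E → ∀ m → E (suc m) 0 ≈ 0# × E (suc m) 1 ≈ 0#
      column E≈0 m = E≈0 (suc m) 0 (ℕ.s≤s ℕ.z≤n) , E≈0 (suc m) 1 (ℕ.s≤s (ℕ.s≤s ℕ.z≤n))

    Det-interleave-step : ∀ n {E O} → Vanishing E → Vanishing O →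
      Det (matrix (suc (suc n)) (interleave E O))
        ≈ block E O 0 * Det (matrix n (interleave (shift₂ E) (shift₂ O)))
    Det-interleave-step n {E} {O} E≈0 O≈0 = trans
      (Det-block (matrix (suc (suc n)) (interleave E O))
        (λ i → proj₁ (interleave-vanishing E≈0 O≈0 (toℕ i))) (λ i → proj₂ (interleave-vanishing E≈0 O≈0 (toℕ i))))
      (*-congˡ (Det-cong λ i j → reflexive (interleave-shift₂ E O (toℕ i) (toℕ j))))

  Det-interleave-even : ∀ m {E O} → Vanishing E → Vanishing O →
    Det (λ (i j : Fin (m ℕ.* 2)) → interleave E O (toℕ i) (toℕ j)) ≈ ∏< (block E O) m
  Det-interleave-even zero            E≈0 O≈0 = Det-zero _
  Det-interleave-even (suc m) {E} {O} E≈0 O≈0 = trans (Det-interleave-step (m ℕ.* 2) E≈0 O≈0)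
    (trans (*-congˡ (Det-interleave-even m (vanishing-shift₂ E≈0) (vanishing-shift₂ O≈0)))
      (sym (∏<-front (block E O) m)))

  Det-interleave-odd : ∀ m {E O} → Vanishing E → Vanishing O →
    Det (λ (i j : Fin (suc (m ℕ.* 2))) → interleave E O (toℕ i) (toℕ j))
      ≈ ∏< (block E O) m * E m (m ℕ.* 2)
  Det-interleave-odd zero            E≈0 O≈0 = trans (Det-first-column _ (λ ()))
    (trans (*-congˡ (Det-zero _)) (*-comm _ _))
  Det-interleave-odd (suc m) {E} {O} E≈0 O≈0 = trans (Det-interleave-step (suc (m ℕ.* 2)) E≈0 O≈0)
    (trans (*-congˡ (Det-interleave-odd m (vanishing-shift₂ E≈0) (vanishing-shift₂ O≈0)))
      (trans (sym (*-assoc _ _ _)) (*-congʳ (sym (∏<-front (block E O) m)))))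

open import Defs
open import Algebra.Properties.Semiring.Exp (CommutativeRing.semiring ℚ.+-*-commutativeRing) using (^-assocʳ)
open import Algebra.Properties.Semiring.Sum (CommutativeRing.semiring ℚ.+-*-commutativeRing) using (*-distribˡ-sum; sum-cong-≗)
open import Data.Integer.Base as ℤ using (+_; 1ℤ; -1ℤ)
import Data.Integer.Properties as ℤ
open import Data.Nat.DivMod using (m*n/n≡m; m≡m%n+[m/n]*n)
open import Data.Nat.Properties using (m^n≢0; _!≢0)
open import Data.Rational.Base using (ℚ; 0ℚ; 1ℚ; ½; _+_; _*_; _-_; -_; _/_; fromℚᵘ)
open import Data.Rational.Solver using (module +-*-Solver)
open import Data.Rational.Unnormalised.Base as ℚᵘ using (*≡*)
import Data.Rational.Unnormalised.Properties as ℚᵘ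
open import Data.Sum.Base using (inj₁; inj₂)
open import Function.Base using (case_of_)
open import Relation.Binary.PropositionalEquality using (refl; sym; trans; cong; cong₂; subst; module ≡-Reasoning)
open +-*-Solver using (solve; _:+_; _:*_; _:-_; :-_; con; _:=_)
open ≡-Reasoning
open Determinant ℚ.+-*-commutativeRing

-- Alternating sums over ℚ

-- Since `_/_` cancels a gcd, `ι n` is stuck for variable `n`; the arithmetic of `ι` is done on
-- unnormalised fractions and carried back.
fromℚᵘ-homo-+ : ∀ p q → fromℚᵘ p + fromℚᵘ q ≡ fromℚᵘ (p ℚᵘ.+ q)
fromℚᵘ-homo-+ p q = ℚ.toℚᵘ-injective (ℚᵘ.≃-trans (ℚ.toℚᵘ-homo-+ (fromℚᵘ p) (fromℚᵘ q))
  (ℚᵘ.≃-trans (ℚᵘ.+-cong (ℚ.toℚᵘ-fromℚᵘ p) (ℚ.toℚᵘ-fromℚᵘ q)) (ℚᵘ.≃-sym (ℚ.toℚᵘ-fromℚᵘ (p ℚᵘ.+ q)))))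

fromℚᵘ-homo-* : ∀ p q → fromℚᵘ p * fromℚᵘ q ≡ fromℚᵘ (p ℚᵘ.* q)
fromℚᵘ-homo-* p q = ℚ.toℚᵘ-injective (ℚᵘ.≃-trans (ℚ.toℚᵘ-homo-* (fromℚᵘ p) (fromℚᵘ q))
  (ℚᵘ.≃-trans (ℚᵘ.*-cong (ℚ.toℚᵘ-fromℚᵘ p) (ℚ.toℚᵘ-fromℚᵘ q)) (ℚᵘ.≃-sym (ℚ.toℚᵘ-fromℚᵘ (p ℚᵘ.* q)))))

ι-suc : ∀ n → ι (suc n) ≡ ι n + 1ℚ
ι-suc n = sym (trans (fromℚᵘ-homo-+ (ℚᵘ.mkℚᵘ (+ n) 0) (ℚᵘ.mkℚᵘ 1ℤ 0))
  (cong (λ i → i / 1) (trans (cong (ℤ._+ 1ℤ) (ℤ.*-identityʳ (+ n))) (cong +_ (ℕ.+-comm n 1)))))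

ι-* : ∀ m n → ι (m ℕ.* n) ≡ ι m * ι n
ι-* m n = sym (trans (fromℚᵘ-homo-* (ℚᵘ.mkℚᵘ (+ m) 0) (ℚᵘ.mkℚᵘ (+ n) 0)) (cong (λ i → i / 1) (sym (ℤ.pos-* m n))))

/-*-ι : ∀ i n .{{_ : ℕ.NonZero n}} → (i / n) * ι n ≡ i / 1
/-*-ι i n@(suc d) = trans (fromℚᵘ-homo-* (ℚᵘ.mkℚᵘ i d) (ℚᵘ.mkℚᵘ (+ n) 0))
  (ℚ.fromℚᵘ-cong {ℚᵘ.mkℚᵘ i d ℚᵘ.* ℚᵘ.mkℚᵘ (+ n) 0} {ℚᵘ.mkℚᵘ i 0} (*≡* (trans (ℤ.*-identityʳ _) (cong (i ℤ.*_) (cong +_ (sym (ℕ.*-identityʳ n)))))))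

alt : ℕ → (ℕ → ℚ) → ℚ
alt zero    f = 0ℚ
alt (suc n) f = f zero - alt n (λ i → f (suc i))

alt-cong : ∀ n {f g} → (∀ i → i ℕ.< n → f i ≡ g i) → alt n f ≡ alt n g
alt-cong zero    f≡g = refl
alt-cong (suc n) f≡g = cong₂ _-_ (f≡g zero (ℕ.s≤s ℕ.z≤n)) (alt-cong n λ i i<n → f≡g (suc i) (ℕ.s≤s i<n))

alt-linear : ∀ n a f b g → alt n (λ i → a * f i + b * g i) ≡ a * alt n f + b * alt n g
alt-linear zero    a f b g = solve 2 (λ a b → con 0ℚ := a :* con 0ℚ :+ b :* con 0ℚ) refl a b
alt-linear (suc n) a f b g = trans (cong (λ z → a * f 0 + b * g 0 - z) (alt-linear n a _ b _))
  (solve 6 (λ a b f₀ g₀ F G → a :* f₀ :+ b :* g₀ :- (a :* F :+ b :* G) := a :* (f₀ :- F) :+ b :* (g₀ :- G))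
    refl a b (f 0) (g 0) _ _)

-- Under alternating signs a sum of neighbours telescopes as a difference does under a plain sum.
-- The end values add for `n` odd and subtract for `n` even.
alt-telescope : ∀ n (d : ℕ → ℚ) → alt n (λ i → d i + d (suc i)) ≡ d 0 - (- 1ℚ) ^ n * d n
alt-telescope zero    d = solve 1 (λ d → con 0ℚ := d :- con 1ℚ :* d) refl (d 0)
alt-telescope (suc n) d = trans (cong (λ z → d 0 + d 1 - z) (alt-telescope n (λ i → d (suc i))))
  (solve 4 (λ d₀ d₁ p d → d₀ :+ d₁ :- (d₁ :- p :* d) := d₀ :- (:- con 1ℚ) :* p :* d) refl (d 0) (d 1) ((- 1ℚ) ^ n) (d (suc n)))

alt-last : ∀ n f → alt (suc n) f ≡ alt n f + (- 1ℚ) ^ n * f n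
alt-last zero    f = solve 1 (λ f → f :- con 0ℚ := con 0ℚ :+ con 1ℚ :* f) refl (f 0)
alt-last (suc n) f = trans (cong (λ z → f 0 - z) (alt-last n _))
  (solve 4 (λ f₀ F p f → f₀ :- (F :+ p :* f) := f₀ :- F :+ (:- con 1ℚ) :* p :* f) refl (f 0) _ ((- 1ℚ) ^ n) (f (suc n)))

-1^n*-1^n : ∀ n → (- 1ℚ) ^ n * (- 1ℚ) ^ n ≡ 1ℚ
-1^n*-1^n zero    = refl
-1^n*-1^n (suc n) = trans (solve 1 (λ p → (:- con 1ℚ) :* p :* ((:- con 1ℚ) :* p) := p :* p) refl ((- 1ℚ) ^ n)) (-1^n*-1^n n)

-1^[n*2] : ∀ n → (- 1ℚ) ^ (n ℕ.* 2) ≡ 1ℚ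
-1^[n*2] zero    = refl
-1^[n*2] (suc n) = trans (solve 1 (λ p → (:- con 1ℚ) :* ((:- con 1ℚ) :* p) := p) refl ((- 1ℚ) ^ (n ℕ.* 2))) (-1^[n*2] n)

alt-reverse : ∀ n f → alt n (λ i → f (n ∸ suc i)) ≡ - ((- 1ℚ) ^ n * alt n f)
alt-reverse zero    f = refl
alt-reverse (suc n) f = begin
  f n - alt n (λ i → f (n ∸ suc i))
    ≡⟨ cong (λ z → f n - z) (alt-reverse n f) ⟩
  f n - - (p * alt n f)
    ≡⟨ solve 3 (λ f p a → f :- :- (p :* a) := con 1ℚ :* f :+ p :* a) refl (f n) p (alt n f) ⟩
  1ℚ * f n + p * alt n f
    ≡⟨ cong (λ z → z * f n + p * alt n f) (sym (-1^n*-1^n n)) ⟩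
  p * p * f n + p * alt n f
    ≡⟨ solve 3 (λ f p a → p :* p :* f :+ p :* a := :- ((:- con 1ℚ) :* p :* (a :+ p :* f))) refl (f n) p (alt n f) ⟩
  - (- 1ℚ * p * (alt n f + p * f n))
    ≡⟨ cong (λ z → - (- 1ℚ * p * z)) (sym (alt-last n f)) ⟩
  - ((- 1ℚ) ^ suc n * alt (suc n) f) ∎
  where
  p : ℚ
  p = (- 1ℚ) ^ n

ι-^ : ∀ m n → ι (m ℕ.^ n) ≡ ι m ^ n
ι-^ m zero    = refl
ι-^ m (suc n) = trans (ι-* m (m ℕ.^ n)) (cong (ι m *_) (ι-^ m n))

-1^/1 : ∀ m → (-1ℤ ℤ.^ m) / 1 ≡ (- 1ℚ) ^ m
-1^/1 zero    = refl
-1^/1 (suc m) = trans (sym (fromℚᵘ-homo-* (ℚᵘ.mkℚᵘ -1ℤ 0) (ℚᵘ.mkℚᵘ (-1ℤ ℤ.^ m) 0))) (cong (- 1ℚ *_) (-1^/1 m))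

x≡-x⇒x≡0 : ∀ {x} → x ≡ - x → x ≡ 0ℚ
x≡-x⇒x≡0 {x} eq = begin
  x              ≡⟨ solve 1 (λ x → x := con ½ :* (x :+ x)) refl x ⟩
  ½ * (x + x)    ≡⟨ cong (λ z → ½ * (x + z)) eq ⟩
  ½ * (x + - x)  ≡⟨ solve 1 (λ x → con ½ :* (x :+ :- x) := con 0ℚ) refl x ⟩
  0ℚ             ∎

-- Reversing the order multiplies the sum by `- (- 1ℚ) ^ n`, the symmetry of `f` by `(- 1ℚ) ^ n`. So
-- `p * a` is its own negative, and `p` is a unit.
alt-skew : ∀ n f → (∀ i → i ℕ.< n → f (n ∸ suc i) ≡ (- 1ℚ) ^ n * f i) → alt n f ≡ 0ℚ
alt-skew n f skew = trans (sym (ℚ.*-identityˡ a)) (trans (cong (_* a) (sym (-1^n*-1^n n)))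
  (trans (ℚ.*-assoc p p a) (trans (cong (p *_) (x≡-x⇒x≡0 (begin
    p * a                                    ≡⟨ solve 2 (λ p a → p :* a := p :* a :+ con 0ℚ :* a) refl p a ⟩
    p * a + 0ℚ * a                           ≡⟨ sym (alt-linear n p f 0ℚ f) ⟩
    alt n (λ i → p * f i + 0ℚ * f i)
      ≡⟨ alt-cong n (λ i i<n → trans (solve 2 (λ p a → p :* a :+ con 0ℚ :* a := p :* a) refl p (f i)) (sym (skew i i<n))) ⟩
    alt n (λ i → f (n ∸ suc i))              ≡⟨ alt-reverse n f ⟩
    - (p * a)                                ∎))) (ℚ.*-zeroʳ p))))
  where
  a p : ℚ
  a = alt n f
  p = (- 1ℚ) ^ n

alt-linear₄ : ∀ n a f b g c h d k → alt n (λ i → a * f i + b * g i + (c * h i + d * k i))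
  ≡ a * alt n f + b * alt n g + (c * alt n h + d * alt n k)
alt-linear₄ n a f b g c h d k = trans
  (alt-cong n λ i _ → solve 2 (λ x y → x :+ y := con 1ℚ :* x :+ con 1ℚ :* y) refl (a * f i + b * g i) (c * h i + d * k i))
  (trans (alt-linear n 1ℚ _ 1ℚ _) (trans
    (solve 2 (λ x y → con 1ℚ :* x :+ con 1ℚ :* y := x :+ y) refl (alt n (λ i → a * f i + b * g i)) (alt n (λ i → c * h i + d * k i)))
    (cong₂ _+_ (alt-linear n a f b g) (alt-linear n c h d k))))

ι-+ : ∀ m n → ι (m ℕ.+ n) ≡ ι m + ι n
ι-+ zero    n = sym (ℚ.+-identityˡ (ι n))
ι-+ (suc m) n = trans (ι-suc (m ℕ.+ n)) (trans (cong (_+ 1ℚ) (ι-+ m n)) (trans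
  (solve 2 (λ m n → m :+ n :+ con 1ℚ := m :+ con 1ℚ :+ n) refl (ι m) (ι n)) (cong (_+ ι n) (sym (ι-suc m)))))

ι-reflect : ∀ {i s} → i ℕ.< s → ι (suc (s ∸ suc i)) ≡ ι s + 1ℚ - ι (suc i)
ι-reflect {i} {s} i<s = begin
  ι (suc (s ∸ suc i))                            ≡⟨ solve 2 (λ a b → a := a :+ b :- b) refl _ (ι (suc i)) ⟩
  ι (suc (s ∸ suc i)) + ι (suc i) - ι (suc i)    ≡⟨ cong (_- ι (suc i)) (sym (ι-+ (suc (s ∸ suc i)) (suc i))) ⟩
  ι (suc (s ∸ suc i ℕ.+ suc i)) - ι (suc i)      ≡⟨ cong (λ n → ι (suc n) - ι (suc i)) (ℕ.m∸n+n≡m i<s) ⟩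
  ι (suc s) - ι (suc i)                          ≡⟨ cong (_- ι (suc i)) (ι-suc s) ⟩
  ι s + 1ℚ - ι (suc i)                           ∎

-- Moments of the alternating functional

sum-alt : ∀ n f → sum {n} (λ i → (- 1ℚ) ^ toℕ i * f (toℕ i)) ≡ alt n f
sum-alt zero    f = refl
sum-alt (suc n) f = cong₂ _+_ (ℚ.*-identityˡ (f 0)) (begin
  sum {n} (λ i → (- 1ℚ) * (- 1ℚ) ^ toℕ i * f (suc (toℕ i)))
    ≡⟨ sum-cong-≗ {n} {λ i → (- 1ℚ) * (- 1ℚ) ^ toℕ i * f (suc (toℕ i))} (λ i → ℚ.*-assoc (- 1ℚ) ((- 1ℚ) ^ toℕ i) (f (suc (toℕ i)))) ⟩
  sum {n} (λ i → (- 1ℚ) * ((- 1ℚ) ^ toℕ i * f (suc (toℕ i))))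
    ≡⟨ sym (*-distribˡ-sum {n} (- 1ℚ) (λ i → (- 1ℚ) ^ toℕ i * f (suc (toℕ i)))) ⟩
  - 1ℚ * sum {n} (λ i → (- 1ℚ) ^ toℕ i * f (suc (toℕ i)))
    ≡⟨ cong (- 1ℚ *_) (sum-alt n (λ i → f (suc i))) ⟩
  - 1ℚ * alt n (λ i → f (suc i))
    ≡⟨ solve 1 (λ a → (:- con 1ℚ) :* a := :- a) refl (alt n (λ i → f (suc i))) ⟩
  - alt n (λ i → f (suc i)) ∎)

T≡alt : ∀ k s → T k s ≡ alt s (λ i → ι (suc i) ^ k)
T≡alt k s = sum-alt s (λ i → ι (suc i) ^ k)

-- L(f xʲ), with `f i` the value at the point i + 1. As a function of `j` it is a row of the
-- transformed matrix.
moment : ℕ → (ℕ → ℚ) → ℕ → ℚ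
moment s f j = alt s (λ i → f i * ι (suc i) ^ j)

-- Four terms are the longest recurrence below; shorter ones take the same shape with zero
-- coefficients.
moment-linear : ∀ s j a f b g c h d k {l} → (∀ i → l i ≡ a * f i + b * g i + (c * h i + d * k i)) →
  moment s l j ≡ a * moment s f j + b * moment s g j + (c * moment s h j + d * moment s k j)
moment-linear s j a f b g c h d k l≡ = trans (alt-cong s λ i _ → trans (cong (_* ι (suc i) ^ j) (l≡ i))
    (solve 9 (λ x a f b g c h d k → (a :* f :+ b :* g :+ (c :* h :+ d :* k)) :* x
        := a :* (f :* x) :+ b :* (g :* x) :+ (c :* (h :* x) :+ d :* (k :* x))) refl
      (ι (suc i) ^ j) a (f i) b (g i) c (h i) d (k i)))
  (alt-linear₄ s a _ b _ c _ d _)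

moment-suc : ∀ s f j → moment s f (suc j) ≡ moment s (λ i → ι (suc i) * f i) j
moment-suc s f j = alt-cong s λ i _ → solve 3 (λ f x y → f :* (x :* y) := x :* f :* y) refl (f i) (ι (suc i)) (ι (suc i) ^ j)

H≡Det : ∀ n s → H n (λ k → T k s) ≡ Det {suc n} (λ i j → moment s (λ _ → 1ℚ) (toℕ i ℕ.+ toℕ j))
H≡Det n s = trans (sym (Det≈det _)) (Det-cong λ i j → trans (T≡alt (toℕ i ℕ.+ toℕ j) s)
  (alt-cong s λ k _ → sym (ℚ.*-identityˡ _)))

-- Products with exponents descending by two

∏<-cong : ∀ n {f g} → (∀ i → i ℕ.< n → f i ≡ g i) → ∏< f n ≡ ∏< g n
∏<-cong zero    f≡g = refl
∏<-cong (suc n) f≡g = cong₂ _*_ (∏<-cong n λ i i<n → f≡g i (ℕ.m<n⇒m<1+n i<n)) (f≡g n (ℕ.n<1+n n))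

∏<-zero : ∀ {n i} f → i ℕ.< n → f i ≡ 0ℚ → ∏< f n ≡ 0ℚ
∏<-zero {suc n} {i} f (ℕ.s≤s i≤n) fi≡0 with ℕ.m≤n⇒m<n∨m≡n i≤n
... | inj₁ i<n  = trans (cong (_* f n) (∏<-zero f i<n fi≡0)) (ℚ.*-zeroˡ (f n))
... | inj₂ refl = trans (cong (∏< f n *_) fi≡0) (ℚ.*-zeroʳ (∏< f n))

product≡∏< : ∀ n f → product {n} (λ i → f (toℕ i)) ≡ ∏< f n
product≡∏< zero    f = refl
product≡∏< (suc n) f = trans (cong (f 0 *_) (product≡∏< n (λ i → f (suc i)))) (sym (∏<-front f n))

^-2* : ∀ x n → x ^ (2 ℕ.* n) ≡ (x * x) ^ n
^-2* x n = trans (sym (^-assocʳ x 2 n)) (cong (λ z → (x * z) ^ n) (ℚ.*-identityʳ x))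

^-2*-suc : ∀ x n → x ^ (2 ℕ.* suc n) ≡ x ^ (2 ℕ.* n) * (x * x)
^-2*-suc x n = trans (^-2* x (suc n)) (trans (ℚ.*-comm (x * x) ((x * x) ^ n)) (cong (_* (x * x)) (sym (^-2* x n))))

suc-∸ : ∀ {i n} → i ℕ.≤ n → suc n ∸ i ≡ suc (n ∸ i)
suc-∸ i≤n = ℕ.+-∸-assoc 1 i≤n

∏<-power-step : ∀ {k} n f → n ℕ.≤ suc k →
  ∏< (λ i → f i ^ (2 ℕ.* (suc k ∸ i))) n ≡ ∏< (λ i → f i ^ (2 ℕ.* (k ∸ i))) n * (∏< f n * ∏< f n)
∏<-power-step     zero    f _  = refl
∏<-power-step {k} (suc n) f (ℕ.s≤s n≤k) = trans
  (cong₂ _*_ (∏<-power-step n f (ℕ.m≤n⇒m≤1+n n≤k))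
    (trans (cong (λ e → f n ^ (2 ℕ.* e)) (suc-∸ n≤k)) (^-2*-suc (f n) (k ∸ n))))
  (solve 4 (λ p q x y → p :* (q :* q) :* (y :* (x :* x)) := p :* y :* (q :* x :* (q :* x))) refl
    (∏< (λ i → f i ^ (2 ℕ.* (k ∸ i))) n) (∏< f n) (f n) (f n ^ (2 ℕ.* (k ∸ n))))

evenPowers : (ℕ → ℚ) → ℕ → ℚ
evenPowers f m = ∏< (λ i → f i ^ (2 ℕ.* (m ∸ i))) m

-- All exponents rise by two from `m` to `suc m`, so the power product is a product of squares of
-- partial products. Determinants grow in the same way, since the diagonal entries are such partial
-- products up to constants.
evenPowers-suc : ∀ f m → evenPowers f (suc m) ≡ evenPowers f m * (∏< f (suc m) * ∏< f (suc m))
evenPowers-suc f m = trans (∏<-power-step (suc m) f ℕ.≤-refl)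
  -- The power step leaves `suc m` factors, the last one with exponent zero.
  (cong (_* (∏< f (suc m) * ∏< f (suc m)))
    (trans (cong (λ e → evenPowers f m * f m ^ (2 ℕ.* e)) (ℕ.n∸n≡0 m)) (ℚ.*-identityʳ (evenPowers f m))))

∏≡evenPowers : ∀ (g : ℕ → ℚ) m → ∏[ ℓ ∈ 1 ⋯ m ] (g ℓ ^ (2 ℕ.* ((m ℕ.+ 1) ∸ ℓ))) ≡ evenPowers (λ i → g (suc i)) m
∏≡evenPowers g m = trans (product≡∏< m (λ i → g (suc i) ^ (2 ℕ.* ((m ℕ.+ 1) ∸ suc i))))
  (∏<-cong m λ i _ → cong (λ e → g (suc i) ^ (2 ℕ.* (e ∸ suc i))) (ℕ.+-comm m 1))

oddPowers : (ℕ → ℚ) → (ℕ → ℚ) → ℕ → ℚ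
oddPowers q f m = ∏< (λ i → q i * f i ^ (2 ℕ.* (m ∸ i) ℕ.+ 1)) (suc m)

^-+1 : ∀ x n → x ^ (n ℕ.+ 1) ≡ x * x ^ n
^-+1 x n = cong (x ^_) (ℕ.+-comm n 1)

oddPowers-suc : ∀ q f m → oddPowers q f (suc m)
  ≡ oddPowers q f m * (∏< f (suc m) * ∏< f (suc m)) * (q (suc m) * f (suc m))
oddPowers-suc q f m = cong₂ _*_ (go (suc m) ℕ.≤-refl)
  (cong (q (suc m) *_) (trans (cong (λ e → f (suc m) ^ (2 ℕ.* e ℕ.+ 1)) (ℕ.n∸n≡0 m)) (ℚ.*-identityʳ (f (suc m)))))
  where
  go : ∀ n → n ℕ.≤ suc m → ∏< (λ i → q i * f i ^ (2 ℕ.* (suc m ∸ i) ℕ.+ 1)) n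
    ≡ ∏< (λ i → q i * f i ^ (2 ℕ.* (m ∸ i) ℕ.+ 1)) n * (∏< f n * ∏< f n)
  go zero    _           = refl
  go (suc n) (ℕ.s≤s n≤m) = trans
    (cong₂ _*_ (go n (ℕ.m≤n⇒m≤1+n n≤m)) (cong (q n *_)
      (trans (^-+1 (f n) (2 ℕ.* (suc m ∸ n)))
        (trans (cong (λ e → f n * f n ^ (2 ℕ.* e)) (suc-∸ n≤m)) (cong (f n *_) (^-2*-suc (f n) (m ∸ n)))))))
    (trans (solve 5 (λ p g c x y → p :* (g :* g) :* (c :* (x :* (y :* (x :* x)))) := p :* (c :* (x :* y)) :* (g :* x :* (g :* x))) refl
      (∏< (λ i → q i * f i ^ (2 ℕ.* (m ∸ i) ℕ.+ 1)) n) (∏< f n) (q n) (f n) (f n ^ (2 ℕ.* (m ∸ n))))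
      (cong (λ e → ∏< (λ i → q i * f i ^ (2 ℕ.* (m ∸ i) ℕ.+ 1)) n * (q n * e) * (∏< f (suc n) * ∏< f (suc n)))
        (sym (^-+1 (f n) (2 ℕ.* (m ∸ n))))))

∏≡oddPowers : ∀ q f m → ∏[ ℓ ∈ 0 ⋯ m ] (q ℓ * f ℓ ^ (2 ℕ.* (m ∸ ℓ) ℕ.+ 1)) ≡ oddPowers q f m
∏≡oddPowers q f m = product≡∏< (suc m) (λ i → q i * f i ^ (2 ℕ.* (m ∸ i) ℕ.+ 1))

H-2* : ∀ m c → H (2 ℕ.* m) c ≡ H (m ℕ.* 2) c
H-2* m c = cong (λ n → H n c) (ℕ.*-comm 2 m)

H-2*+1 : ∀ m c → H (2 ℕ.* m ℕ.+ 1) c ≡ H (suc (m ℕ.* 2)) c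
H-2*+1 m c = cong (λ n → H n c) (trans (ℕ.+-comm (2 ℕ.* m) 1) (cong suc (ℕ.*-comm 2 m)))

combination≡0 : ∀ a b c d {x y z w} → x ≡ 0ℚ → y ≡ 0ℚ → z ≡ 0ℚ → w ≡ 0ℚ → a * x + b * y + (c * z + d * w) ≡ 0ℚ
combination≡0 a b c d refl refl refl refl =
  solve 4 (λ a b c d → a :* con 0ℚ :+ b :* con 0ℚ :+ (c :* con 0ℚ :+ d :* con 0ℚ) := con 0ℚ) refl a b c d

only-second : ∀ a b c d {x y z w} → x ≡ 0ℚ → z ≡ 0ℚ → w ≡ 0ℚ → a * x + b * y + (c * z + d * w) ≡ b * y
only-second a b c d {y = y} refl refl refl =
  solve 5 (λ a b c d y → a :* con 0ℚ :+ b :* y :+ (c :* con 0ℚ :+ d :* con 0ℚ) := b :* y) refl a b c d y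

-- Hankel rows and the orthogonal family

hankel : ℕ → ℕ → ℕ → ℚ
hankel s k j = moment s (λ _ → 1ℚ) (k ℕ.+ j)

hankel-suc : ∀ s k j → hankel s k (suc j) ≡ hankel s (suc k) j
hankel-suc s k j = cong (moment s (λ _ → 1ℚ)) (ℕ.+-suc k j)

-- The inductive step of `N-vQe`, with `f`, `w`, `k`, `m` standing for `∏< A k`, `w m k`, `ι k`,
-- `ι m`. Taking out the common factor `n * f * (w * m′)` first leaves a polynomial identity in `k`,
-- `m`, `ε`, `σ` alone.
contiguity : ∀ n f w k m m′ m″ ε σ → m′ ≡ m + 1ℚ → m″ ≡ m′ + 1ℚ →
  1ℚ * (k * (k + ε) * (n * f * (w * - (m′ * (k - m))))
        + - 1ℚ * (n * (f * (k * (k + 1ℚ + ε) - σ)) * (- (m′ * (k + 1ℚ)) * w)))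
    + m′ * m′ * (n * f * w * - (m′ * (k - m) + (m * (m + 1ℚ + ε) - σ)))
  ≡ n * f * (w * - (m′ * (k - m))) * - (m″ * (k - m′) + (m′ * (m′ + 1ℚ + ε) - σ))
contiguity n f w k m _ _ ε σ refl refl = trans
  (solve 9 (λ n f w k k′ a m′ d b →
      con 1ℚ :* (k :* (n :* f :* (w :* :- (m′ :* d))) :+ (:- con 1ℚ) :* (n :* (f :* a) :* (:- (m′ :* k′) :* w)))
        :+ m′ :* m′ :* (n :* f :* w :* b)
      := n :* f :* (w :* m′) :* (k′ :* a :- k :* d :+ m′ :* b))
    refl n f w (k * (k + ε)) (k + 1ℚ) (k * (k + 1ℚ + ε) - σ) (m + 1ℚ) (k - m) (- ((m + 1ℚ) * (k - m) + (m * (m + 1ℚ + ε) - σ))))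
  (trans (cong (n * f * (w * (m + 1ℚ)) *_)
    (solve 4 (λ k m ε σ →
        (k :+ con 1ℚ) :* (k :* (k :+ con 1ℚ :+ ε) :- σ) :- k :* (k :+ ε) :* (k :- m)
          :+ (m :+ con 1ℚ) :* :- ((m :+ con 1ℚ) :* (k :- m) :+ (m :* (m :+ con 1ℚ :+ ε) :- σ))
        := (k :- m) :* ((m :+ con 1ℚ :+ con 1ℚ) :* (k :- (m :+ con 1ℚ)) :+ ((m :+ con 1ℚ) :* (m :+ con 1ℚ :+ con 1ℚ :+ ε) :- σ)))
      refl k m ε σ))
    (solve 6 (λ n f w m′ d b → n :* f :* (w :* m′) :* (d :* b) := n :* f :* (w :* :- (m′ :* d)) :* :- b)
      refl n f w (m + 1ℚ) (k - m) ((m + 1ℚ + 1ℚ) * (k - (m + 1ℚ)) + ((m + 1ℚ) * (m + 1ℚ + 1ℚ + ε) - σ))))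

-- s odd takes v = y², ε = 0 and s even takes v = z² - z, ε = 1, where y and z are the shifted points.
module Orthogonal (s : ℕ) (u v : ℕ → ℚ) (ε σ N₀ : ℚ) where

  A : ℕ → ℚ
  A k = ι k * (ι k + 1ℚ + ε) - σ

  e : ℕ → ℕ → ℚ
  e zero    i = 1ℚ
  e (suc k) i = e k i * (ι k * (ι k + ε) - v i)

  -- For v = y² the functions `P m` and y `Q m` are the even and odd members of one symmetric
  -- sequence, whose recurrence coefficients alternate between m² and `A m`. Splitting the
  -- recurrence of `P` through `Q` exposes these two factors.
  P Q : ℕ → ℕ → ℚ
  P zero    i = 1ℚ
  P (suc m) i = v i * Q m i + A m * P m i
  Q zero    i = 1ℚ
  Q (suc m) i = P (suc m) i + ι (suc m) * ι (suc m) * Q m i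

  N : (ℕ → ℚ) → ℚ
  N f = alt s (λ i → u i * f i)

  N-linear : ∀ a f b g {h} → (∀ i → h i ≡ a * f i + b * g i) → N h ≡ a * N f + b * N g
  N-linear a f b g h≡ = trans
    (alt-cong s λ i _ → trans (cong (u i *_) (h≡ i))
      (solve 5 (λ u a f b g → u :* (a :* f :+ b :* g) := a :* (u :* f) :+ b :* (u :* g)) refl (u i) a (f i) b (g i)))
    (alt-linear s a _ b _)

  -- w m k = (-1)^m m! k (k - 1) ⋯ (k - m + 1)
  w : ℕ → ℕ → ℚ
  w zero    k = 1ℚ
  w (suc m) k = w m k * - (ι (suc m) * (ι k - ι m))

  -- The definition of `w` appends the last factor of the falling factorial; this takes off the
  -- first, which relates `suc k` to `k`.
  w-suc-suc : ∀ m k → w (suc m) (suc k) ≡ - (ι (suc m) * ι (suc k)) * w m k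
  w-suc-suc zero    k = solve 2 (λ a b → con 1ℚ :* :- (a :* (b :- con 0ℚ)) := :- (a :* b) :* con 1ℚ) refl (ι 1) (ι (suc k))
  w-suc-suc (suc m) k = begin
    w (suc m) (suc k) * - (ι (suc (suc m)) * (ι (suc k) - ι (suc m)))
      ≡⟨ cong₂ (λ x y → x * - (ι (suc (suc m)) * y)) (w-suc-suc m k)
           (trans (cong₂ _-_ (ι-suc k) (ι-suc m))
             (solve 2 (λ k m → k :+ con 1ℚ :- (m :+ con 1ℚ) := k :- m) refl (ι k) (ι m))) ⟩
    - (ι (suc m) * ι (suc k)) * w m k * - (ι (suc (suc m)) * (ι k - ι m))
      ≡⟨ solve 5 (λ a b c w d → :- (a :* b) :* w :* :- (c :* d) := :- (c :* b) :* (w :* :- (a :* d))) refl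
           (ι (suc m)) (ι (suc k)) (ι (suc (suc m))) (w m k) (ι k - ι m) ⟩
    - (ι (suc (suc m)) * ι (suc k)) * w (suc m) k ∎

  module _ (N-e : ∀ k → N (e k) ≡ N₀ * ∏< A k) where

    -- Proved together with `N-vQe` by induction on `m`. `Q m` enters only as v `Q m`, the form in
    -- which `P (suc m)` contains it; adding `A m * P m` then cancels the summand `A m` in the
    -- formula of `N-vQe`.
    N-Pe : ∀ m k → N (λ i → P m i * e k i) ≡ N₀ * ∏< A k * w m k
    N-vQe : ∀ m k → N (λ i → v i * Q m i * e k i)
            ≡ N₀ * ∏< A k * w m k * - (ι (suc m) * (ι k - ι m) + A m)

    N-vPe : ∀ m k → N (λ i → v i * P m i * e k i)
            ≡ ι k * (ι k + ε) * N (λ i → P m i * e k i) + - 1ℚ * N (λ i → P m i * e (suc k) i)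
    N-vPe m k = N-linear (ι k * (ι k + ε)) (λ i → P m i * e k i) (- 1ℚ) (λ i → P m i * e (suc k) i) λ i →
      solve 4 (λ v p e c → v :* p :* e := c :* (p :* e) :+ (:- con 1ℚ) :* (p :* (e :* (c :- v)))) refl
        (v i) (P m i) (e k i) (ι k * (ι k + ε))

    N-Pe zero k = trans (N-linear 1ℚ (e k) 0ℚ (e k) (λ i → solve 1 (λ e → con 1ℚ :* e := con 1ℚ :* e :+ con 0ℚ :* e) refl (e k i)))
      (trans (solve 1 (λ x → con 1ℚ :* x :+ con 0ℚ :* x := x :* con 1ℚ) refl (N (e k))) (cong (_* 1ℚ) (N-e k)))
    N-Pe (suc m) k = begin
      N (λ i → P (suc m) i * e k i)
        ≡⟨ N-linear 1ℚ _ (A m) _ (λ i → solve 5 (λ v q a p e → (v :* q :+ a :* p) :* e := con 1ℚ :* (v :* q :* e) :+ a :* (p :* e)) refl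
             (v i) (Q m i) (A m) (P m i) (e k i)) ⟩
      1ℚ * N (λ i → v i * Q m i * e k i) + A m * N (λ i → P m i * e k i)
        ≡⟨ cong₂ (λ x y → 1ℚ * x + A m * y) (N-vQe m k) (N-Pe m k) ⟩
      1ℚ * (c * - (b + A m)) + A m * c
        ≡⟨ solve 3 (λ c b a → con 1ℚ :* (c :* :- (b :+ a)) :+ a :* c := c :* :- b) refl c b (A m) ⟩
      c * - b
        ≡⟨ ℚ.*-assoc (N₀ * ∏< A k) (w m k) (- b) ⟩
      N₀ * ∏< A k * w (suc m) k ∎
      where
      b c : ℚ
      b = ι (suc m) * (ι k - ι m)
      c = N₀ * ∏< A k * w m k

    N-vQe zero k = begin
      N (λ i → v i * P 0 i * e k i)
        ≡⟨ N-vPe 0 k ⟩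
      ι k * (ι k + ε) * N (λ i → P 0 i * e k i) + - 1ℚ * N (λ i → P 0 i * e (suc k) i)
        ≡⟨ cong₂ (λ x y → ι k * (ι k + ε) * x + - 1ℚ * y) (N-Pe 0 k) (N-Pe 0 (suc k)) ⟩
      ι k * (ι k + ε) * (N₀ * ∏< A k * 1ℚ) + - 1ℚ * (N₀ * (∏< A k * A k) * 1ℚ)
        ≡⟨ solve 5 (λ n f k ε σ →
             k :* (k :+ ε) :* (n :* f :* con 1ℚ) :+ (:- con 1ℚ) :* (n :* (f :* (k :* (k :+ con 1ℚ :+ ε) :- σ)) :* con 1ℚ)
             := n :* f :* con 1ℚ :* :- (con 1ℚ :* (k :- con 0ℚ) :+ (con 0ℚ :* (con 0ℚ :+ con 1ℚ :+ ε) :- σ)))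
             refl N₀ (∏< A k) (ι k) ε σ ⟩
      N₀ * ∏< A k * 1ℚ * - (ι 1 * (ι k - ι 0) + A 0) ∎
    N-vQe (suc m) k = begin
      N (λ i → v i * Q (suc m) i * e k i)
        ≡⟨ N-linear 1ℚ _ (M′ * M′) _ (λ i → solve 5 (λ v p c q e → v :* (p :+ c :* q) :* e := con 1ℚ :* (v :* p :* e) :+ c :* (v :* q :* e)) refl
             (v i) (P (suc m) i) (M′ * M′) (Q m i) (e k i)) ⟩
      1ℚ * N (λ i → v i * P (suc m) i * e k i) + M′ * M′ * N (λ i → v i * Q m i * e k i)
        ≡⟨ cong₂ (λ x y → 1ℚ * x + M′ * M′ * y)
             (trans (N-vPe (suc m) k) (cong₂ (λ x y → K * (K + ε) * x + - 1ℚ * y) (N-Pe (suc m) k) (N-Pe (suc m) (suc k))))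
             (N-vQe m k) ⟩
      1ℚ * (K * (K + ε) * (N₀ * F * w (suc m) k) + - 1ℚ * (N₀ * (F * A k) * w (suc m) (suc k)))
        + M′ * M′ * (N₀ * F * W * - (M′ * (K - M) + A m))
        ≡⟨ cong (λ z → 1ℚ * (K * (K + ε) * (N₀ * F * w (suc m) k) + - 1ℚ * (N₀ * (F * A k) * z))
             + M′ * M′ * (N₀ * F * W * - (M′ * (K - M) + A m)))
             (trans (w-suc-suc m k) (cong (λ z → - (M′ * z) * W) (ι-suc k))) ⟩
      1ℚ * (K * (K + ε) * (N₀ * F * (W * - (M′ * (K - M)))) + - 1ℚ * (N₀ * (F * A k) * (- (M′ * (K + 1ℚ)) * W)))
        + M′ * M′ * (N₀ * F * W * - (M′ * (K - M) + A m))
        ≡⟨ contiguity N₀ F W K M M′ (ι (suc (suc m))) ε σ (ι-suc m) (ι-suc (suc m)) ⟩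
      N₀ * F * w (suc m) k * - (ι (suc (suc m)) * (K - M′) + A (suc m)) ∎
      where
      K M M′ F W : ℚ
      K = ι k
      M = ι m
      M′ = ι (suc m)
      F = ∏< A k
      W = w m k

    w-zero : ∀ m → w (suc m) 0 ≡ 0ℚ
    w-zero zero    = refl
    w-zero (suc m) = trans (cong (_* - (ι (suc (suc m)) * (ι 0 - ι (suc m)))) (w-zero m)) (ℚ.*-zeroˡ (- (ι (suc (suc m)) * (ι 0 - ι (suc m)))))

    N-P : ∀ m → N (P m) ≡ N₀ * w m 0
    N-P m = trans (alt-cong s λ i _ → cong (u i *_) (sym (ℚ.*-identityʳ (P m i))))
      (trans (N-Pe m 0) (cong (_* w m 0) (ℚ.*-identityʳ N₀)))

    N-P-zero : N (P 0) ≡ N₀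
    N-P-zero = trans (N-P 0) (ℚ.*-identityʳ N₀)

    N-P-suc : ∀ m → N (P (suc m)) ≡ 0ℚ
    N-P-suc m = trans (N-P (suc m)) (trans (cong (N₀ *_) (w-zero m)) (ℚ.*-zeroʳ N₀))

  P-cong : ∀ m {i j} → v i ≡ v j → P m i ≡ P m j
  Q-cong : ∀ m {i j} → v i ≡ v j → Q m i ≡ Q m j
  P-cong zero    eq = refl
  P-cong (suc m) eq = cong₂ (λ x y → x + A m * y) (cong₂ _*_ eq (Q-cong m eq)) (P-cong m eq)
  Q-cong zero    eq = refl
  Q-cong (suc m) eq = cong₂ (λ x y → x + ι (suc m) * ι (suc m) * y) (P-cong (suc m) eq) (Q-cong m eq)

  -- At m = 0 the values at pred 0 are multiplied by 0.
  P-by-Q : ∀ m i → P m i ≡ Q m i - ι m * ι m * Q (ℕ.pred m) i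
  P-by-Q zero    i = refl
  P-by-Q (suc m) i = solve 2 (λ p q → p := p :+ q :- q) refl (P (suc m) i) (ι (suc m) * ι (suc m) * Q m i)

  vQ-by-P : ∀ m i → v i * Q m i ≡ P (suc m) i - A m * P m i
  vQ-by-P m i = solve 2 (λ p q → p := p :+ q :- q) refl (v i * Q m i) (A m * P m i)

  -- Eliminating `Q` from the two defining recurrences leaves the three-term recurrence of the
  -- continuous dual Hahn polynomials. It serves s even, where both kinds of rows are built from
  -- `P`.
  vP-by-P : ∀ m i → v i * P m i ≡
    P (suc m) i - (A m + ι m * ι m) * P m i + ι m * ι m * A (ℕ.pred m) * P (ℕ.pred m) i
  vP-by-P zero    i = solve 5 (λ v p q a b → v :* p := v :* p :+ a :* p :- (a :+ con 0ℚ :* con 0ℚ) :* p :+ con 0ℚ :* con 0ℚ :* b :* p) refl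
    (v i) 1ℚ 0ℚ (A 0) (A 0)
  vP-by-P (suc m) i = solve 6 (λ v p q a b c →
      v :* (v :* q :+ b :* p) :=
      v :* (v :* q :+ b :* p :+ c :* q) :+ a :* (v :* q :+ b :* p) :- (a :+ c) :* (v :* q :+ b :* p) :+ c :* b :* p) refl
    (v i) (P m i) (Q m i) (A (suc m)) (A m) (ι (suc m) * ι (suc m))

-- The case s = 2r + 1

module Odd (r : ℕ) where

  s : ℕ
  s = suc (r ℕ.* 2)

  c : ℚ
  c = ι r + 1ℚ

  y : ℕ → ℚ
  y i = ι (suc i) - c

  -- The weight 2 keeps the antidifference free of fractions. The value of σ is that of y (y - 1) at
  -- both ends of the telescope, y = -r and y = r + 1.
  open Orthogonal s (λ _ → 1ℚ + 1ℚ) (λ i → y i * y i) 0ℚ (ι r * (ι r + 1ℚ)) (1ℚ + 1ℚ) public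

  y-suc : ∀ i → y (suc i) ≡ y i + 1ℚ
  y-suc i = trans (cong (_- c) (ι-suc (suc i)))
    (solve 2 (λ x c → x :+ con 1ℚ :- c := x :- c :+ con 1ℚ) refl (ι (suc i)) c)

  -- An antidifference of 2 e k for the alternating sum.
  d : ℕ → ℚ → ℚ
  d k y = ∏< (λ j → ι j * (ι j + 1ℚ) - y * (y - 1ℚ)) k

  -- Up to sign this is the product of y - k, ..., y + k. It divides `e (suc k)` with cofactor y,
  -- `d (suc k)` at y with cofactor y - (k + 1), and at y + 1 with cofactor y + (k + 1); the last
  -- two cofactors add up to 2y.
  e/y : ℕ → ℚ → ℚ
  e/y k y = - y * ∏< (λ j → ι (suc j) * ι (suc j) - y * y) k

  d-e/y : ∀ k y → d (suc k) y ≡ e/y k y * (y - ι (suc k))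
  d-e/y zero y = solve 1 (λ y → con 1ℚ :* (con 0ℚ :* (con 0ℚ :+ con 1ℚ) :- y :* (y :- con 1ℚ)) := :- y :* con 1ℚ :* (y :- con 1ℚ)) refl y
  d-e/y (suc k) y = trans (cong (λ a → a * (K * (K + 1ℚ) - y * (y - 1ℚ))) (d-e/y k y))
    (trans (solve 3 (λ y p K → :- y :* p :* (y :- K) :* (K :* (K :+ con 1ℚ) :- y :* (y :- con 1ℚ))
        := :- y :* (p :* (K :* K :- y :* y)) :* (y :- (K :+ con 1ℚ))) refl
      y (∏< (λ j → ι (suc j) * ι (suc j) - y * y) k) K)
      (cong (λ z → e/y (suc k) y * (y - z)) (sym (ι-suc (suc k)))))
    where
    K : ℚ
    K = ι (suc k)

  d-e/y′ : ∀ k y → d (suc k) (y + 1ℚ) ≡ e/y k y * (y + ι (suc k))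
  d-e/y′ zero y = solve 1 (λ y → con 1ℚ :* (con 0ℚ :* (con 0ℚ :+ con 1ℚ) :- (y :+ con 1ℚ) :* (y :+ con 1ℚ :- con 1ℚ)) := :- y :* con 1ℚ :* (y :+ con 1ℚ)) refl y
  d-e/y′ (suc k) y = trans (cong (λ a → a * (K * (K + 1ℚ) - (y + 1ℚ) * (y + 1ℚ - 1ℚ))) (d-e/y′ k y))
    (trans (solve 3 (λ y p K → :- y :* p :* (y :+ K) :* (K :* (K :+ con 1ℚ) :- (y :+ con 1ℚ) :* (y :+ con 1ℚ :- con 1ℚ))
        := :- y :* (p :* (K :* K :- y :* y)) :* (y :+ (K :+ con 1ℚ))) refl
      y (∏< (λ j → ι (suc j) * ι (suc j) - y * y) k) K)
      (cong (λ z → e/y (suc k) y * (y + z)) (sym (ι-suc (suc k)))))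
    where
    K : ℚ
    K = ι (suc k)

  e-e/y : ∀ k i → e (suc k) i ≡ y i * e/y k (y i)
  e-e/y zero    i = solve 1 (λ y → con 1ℚ :* (con 0ℚ :* (con 0ℚ :+ con 0ℚ) :- y :* y) := y :* (:- y :* con 1ℚ)) refl (y i)
  e-e/y (suc k) i = trans (cong (_* (ι (suc k) * (ι (suc k) + 0ℚ) - y i * y i)) (e-e/y k i))
    (solve 3 (λ y p K → y :* (:- y :* p) :* (K :* (K :+ con 0ℚ) :- y :* y) := y :* (:- y :* (p :* (K :* K :- y :* y)))) refl
      (y i) (∏< (λ j → ι (suc j) * ι (suc j) - y i * y i) k) (ι (suc k)))

  e-antidifference : ∀ k i → (1ℚ + 1ℚ) * e k i ≡ d k (y i) + d k (y (suc i))
  e-antidifference zero    i = refl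
  e-antidifference (suc k) i = trans (cong ((1ℚ + 1ℚ) *_) (e-e/y k i)) (sym (trans
    (cong₂ _+_ (d-e/y k (y i)) (trans (cong (d (suc k)) (y-suc i)) (d-e/y′ k (y i))))
    (solve 3 (λ y q K → q :* (y :- K) :+ q :* (y :+ K) := (con 1ℚ :+ con 1ℚ) :* (y :* q)) refl (y i) (e/y k (y i)) (ι (suc k)))))

  d-ends : ∀ k y → y * (y - 1ℚ) ≡ ι r * (ι r + 1ℚ) → d k y ≡ ∏< A k
  d-ends zero    y eq = refl
  d-ends (suc k) y eq = cong₂ _*_ (d-ends k y eq)
    (cong₂ _-_ (cong (ι k *_) (sym (ℚ.+-identityʳ (ι k + 1ℚ)))) eq)

  ι-s : ι s ≡ ι r + ι r + 1ℚ
  ι-s = trans (ι-suc (r ℕ.* 2)) (cong (_+ 1ℚ) (trans (ι-* r 2) (solve 1 (λ r → r :* con (ι 2) := r :+ r) refl (ι r))))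

  N-e : ∀ k → N (e k) ≡ (1ℚ + 1ℚ) * ∏< A k
  N-e k = begin
    N (e k)
      ≡⟨ alt-cong s (λ i _ → e-antidifference k i) ⟩
    alt s (λ i → d k (y i) + d k (y (suc i)))
      ≡⟨ alt-telescope s (λ i → d k (y i)) ⟩
    d k (y 0) - (- 1ℚ) ^ s * d k (y s)
      ≡⟨ cong₂ _-_ (d-ends k (y 0) (solve 1 (λ r → (con 1ℚ :- (r :+ con 1ℚ)) :* (con 1ℚ :- (r :+ con 1ℚ) :- con 1ℚ) := r :* (r :+ con 1ℚ)) refl (ι r)))
           (cong₂ (λ p z → - 1ℚ * p * z) (-1^[n*2] r) (d-ends k (y s)
             (trans (cong (λ z → (z - c) * (z - c - 1ℚ)) (trans (ι-suc s) (cong (_+ 1ℚ) ι-s)))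
               (solve 1 (λ r → (r :+ r :+ con 1ℚ :+ con 1ℚ :- (r :+ con 1ℚ)) :* (r :+ r :+ con 1ℚ :+ con 1ℚ :- (r :+ con 1ℚ) :- con 1ℚ) := r :* (r :+ con 1ℚ)) refl (ι r))))) ⟩
    ∏< A k - - 1ℚ * 1ℚ * ∏< A k
      ≡⟨ solve 1 (λ F → F :- (:- con 1ℚ) :* con 1ℚ :* F := (con 1ℚ :+ con 1ℚ) :* F) refl (∏< A k) ⟩
    (1ℚ + 1ℚ) * ∏< A k ∎

  E O : ℕ → ℕ → ℚ
  E m = moment s (P m)
  O m = moment s (λ i → y i * Q m i)

  E-start : ∀ m → E m 0 ≡ ½ * N (P m)
  E-start m = trans (alt-cong s λ i _ → solve 1 (λ p → p :* con 1ℚ := con ½ :* ((con 1ℚ :+ con 1ℚ) :* p) :+ con 0ℚ :* con 0ℚ) refl (P m i))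
    (trans (alt-linear s ½ (λ i → (1ℚ + 1ℚ) * P m i) 0ℚ (λ _ → 0ℚ)) (solve 2 (λ a b → a :+ con 0ℚ :* b := a) refl (½ * N (P m)) (alt s (λ _ → 0ℚ))))

  E-zero-start : E 0 0 ≡ 1ℚ
  E-zero-start = trans (E-start 0) (cong (½ *_) (N-P-zero N-e))

  E-suc-start : ∀ m → E (suc m) 0 ≡ 0ℚ
  E-suc-start m = trans (E-start (suc m)) (cong (½ *_) (N-P-suc N-e m))

  y-reflect : ∀ {i} → i ℕ.< s → y (s ∸ suc i) ≡ - y i
  y-reflect {i} i<s = trans (cong (_- c) (trans (ι-reflect i<s) (cong (λ z → z + 1ℚ - ι (suc i)) ι-s)))
    (solve 2 (λ r x → r :+ r :+ con 1ℚ :+ con 1ℚ :- x :- (r :+ con 1ℚ) := :- (x :- (r :+ con 1ℚ))) refl (ι r) (ι (suc i)))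

  O-start : ∀ m → O m 0 ≡ 0ℚ
  O-start m = alt-skew s _ λ i i<s → begin
    y (s ∸ suc i) * Q m (s ∸ suc i) * 1ℚ
      ≡⟨ cong₂ (λ a b → a * b * 1ℚ) (y-reflect i<s)
           (Q-cong m (trans (cong (λ z → z * z) (y-reflect i<s)) (solve 1 (λ y → :- y :* :- y := y :* y) refl (y i)))) ⟩
    - y i * Q m i * 1ℚ
      ≡⟨ solve 2 (λ y q → :- y :* q :* con 1ℚ := (:- con 1ℚ) :* con 1ℚ :* (y :* q :* con 1ℚ)) refl (y i) (Q m i) ⟩
    - 1ℚ * 1ℚ * (y i * Q m i * 1ℚ)
      ≡⟨ cong (λ p → - 1ℚ * p * (y i * Q m i * 1ℚ)) (sym (-1^[n*2] r)) ⟩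
    (- 1ℚ) ^ s * (y i * Q m i * 1ℚ) ∎

  -- Multiplication by x = y + c. Together with `O-next` this is the recurrence of a symmetric
  -- orthogonal sequence, moved from the centre to x.
  E-next : ∀ m j → E m (suc j) ≡ 1ℚ * O m j + - (ι m * ι m) * O (ℕ.pred m) j + (c * E m j + 0ℚ * E m j)
  E-next m j = trans (moment-suc s (P m) j) (moment-linear s j
    1ℚ (λ i → y i * Q m i) (- (ι m * ι m)) (λ i → y i * Q (ℕ.pred m) i) c (P m) 0ℚ (P m) λ i →
    trans (cong (ι (suc i) *_) (P-by-Q m i)) (trans
      (solve 5 (λ x c q a q′ → x :* (q :- a :* q′)
          := con 1ℚ :* ((x :- c) :* q) :+ :- a :* ((x :- c) :* q′) :+ (c :* (q :- a :* q′) :+ con 0ℚ :* (q :- a :* q′))) refl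
        (ι (suc i)) c (Q m i) (ι m * ι m) (Q (ℕ.pred m) i))
      (cong (λ p → 1ℚ * (y i * Q m i) + - (ι m * ι m) * (y i * Q (ℕ.pred m) i) + (c * p + 0ℚ * p)) (sym (P-by-Q m i)))))

  O-next : ∀ m j → O m (suc j) ≡ 1ℚ * E (suc m) j + - A m * E m j + (c * O m j + 0ℚ * O m j)
  O-next m j = trans (moment-suc s (λ i → y i * Q m i) j) (moment-linear s j
    1ℚ (P (suc m)) (- A m) (P m) c (λ i → y i * Q m i) 0ℚ (λ i → y i * Q m i) λ i → begin
    ι (suc i) * (y i * Q m i)
      ≡⟨ solve 3 (λ x c q → x :* ((x :- c) :* q) := (x :- c) :* (x :- c) :* q :+ c :* ((x :- c) :* q)) refl (ι (suc i)) c (Q m i) ⟩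
    y i * y i * Q m i + c * (y i * Q m i)
      ≡⟨ cong (_+ c * (y i * Q m i)) (vQ-by-P m i) ⟩
    P (suc m) i - A m * P m i + c * (y i * Q m i)
      ≡⟨ solve 5 (λ p a p′ c z → p :- a :* p′ :+ c :* z := con 1ℚ :* p :+ :- a :* p′ :+ (c :* z :+ con 0ℚ :* z)) refl
           (P (suc m) i) (A m) (P m i) c (y i * Q m i) ⟩
    1ℚ * P (suc m) i + - A m * P m i + (c * (y i * Q m i) + 0ℚ * (y i * Q m i)) ∎)

  -- Induction on the column for all rows at once: the recurrences express column `suc j` through
  -- column `j` of neighbouring rows. In the first column `E` vanishes by the product formula and
  -- `O` by the reflection, which gives `O` one more zero.
  vanishing : ∀ j → (∀ m → j ℕ.< m ℕ.* 2 → E m j ≡ 0ℚ) × (∀ m → j ℕ.< suc (m ℕ.* 2) → O m j ≡ 0ℚ)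
  vanishing zero = (λ { (suc m) _ → E-suc-start m }) , λ m _ → O-start m
  vanishing (suc j) = E-vanish , O-vanish
    where
    E-vanish : ∀ m → suc j ℕ.< m ℕ.* 2 → E m (suc j) ≡ 0ℚ
    E-vanish (suc m) (ℕ.s≤s j<) = trans (E-next (suc m) j) (combination≡0 1ℚ (- (ι (suc m) * ι (suc m))) c 0ℚ
      (proj₂ (vanishing j) (suc m) (ℕ.m<n⇒m<1+n (ℕ.m<n⇒m<1+n j<))) (proj₂ (vanishing j) m j<)
      (proj₁ (vanishing j) (suc m) (ℕ.m<n⇒m<1+n j<)) (proj₁ (vanishing j) (suc m) (ℕ.m<n⇒m<1+n j<)))
    O-vanish : ∀ m → suc j ℕ.< suc (m ℕ.* 2) → O m (suc j) ≡ 0ℚ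
    O-vanish m (ℕ.s≤s j<) = trans (O-next m j) (combination≡0 1ℚ (- A m) c 0ℚ
      (proj₁ (vanishing j) (suc m) (ℕ.m<n⇒m<1+n (ℕ.m<n⇒m<1+n j<))) (proj₁ (vanishing j) m j<)
      (proj₂ (vanishing j) m (ℕ.m<n⇒m<1+n j<)) (proj₂ (vanishing j) m (ℕ.m<n⇒m<1+n j<)))

  E-vanishing : Vanishing E
  E-vanishing m j = proj₁ (vanishing j) m

  O-vanishing : Vanishing O
  O-vanishing m j j< = proj₂ (vanishing j) m (ℕ.m<n⇒m<1+n j<)

  -- At the diagonal position all terms of the recurrence but one are in the vanishing range, so a
  -- recurrence coefficient becomes the ratio of successive diagonal entries.
  O-diagonal : ∀ m → O m (suc (m ℕ.* 2)) ≡ - A m * E m (m ℕ.* 2)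
  O-diagonal m = trans (O-next m (m ℕ.* 2)) (only-second 1ℚ (- A m) c 0ℚ
    (E-vanishing (suc m) (m ℕ.* 2) (ℕ.m<n⇒m<1+n (ℕ.n<1+n _)))
    (proj₂ (vanishing (m ℕ.* 2)) m (ℕ.n<1+n _)) (proj₂ (vanishing (m ℕ.* 2)) m (ℕ.n<1+n _)))

  E-diagonal : ∀ m → E (suc m) (suc m ℕ.* 2) ≡ - (ι (suc m) * ι (suc m)) * O m (suc (m ℕ.* 2))
  E-diagonal m = trans (E-next (suc m) (suc (m ℕ.* 2))) (only-second 1ℚ (- (ι (suc m) * ι (suc m))) c 0ℚ
    (O-vanishing (suc m) _ (ℕ.n<1+n _)) (E-vanishing (suc m) _ (ℕ.n<1+n _)) (E-vanishing (suc m) _ (ℕ.n<1+n _)))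

  mutual
    E-monic : ∀ m → Monic (hankel s) (m ℕ.* 2) (E m)
    E-monic zero    = (λ _ → 0ℚ) , null (λ _ → refl) , λ j → sym (ℚ.+-identityˡ (E 0 j))
    E-monic (suc m) = monic-shift suc (hankel-suc s) (O-monic m)
      (span-monic (ℕ.n<1+n _) (O-monic m) (- c)
        (span-monic (ℕ.m<n⇒m<1+n (ℕ.n<1+n _)) (E-monic m) (A m) (null {g = λ _ → 0ℚ} (λ _ → refl)) (λ _ → refl)) (λ _ → refl))
      λ j → trans (solve 5 (λ e a e′ c o → e := (con 1ℚ :* e :+ :- a :* e′ :+ (c :* o :+ con 0ℚ :* o)) :+ ((con 0ℚ :+ a :* e′) :+ :- c :* o)) refl
        (E (suc m) j) (A m) (E m j) c (O m j)) (cong (_+ (0ℚ + A m * E m j + - c * O m j)) (sym (O-next m j)))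

    O-monic : ∀ m → Monic (hankel s) (suc (m ℕ.* 2)) (O m)
    -- At `m = 0` the predecessor is 0 again, so the recurrence mentions `O 0` itself with
    -- coefficient zero and has one lower term fewer.
    O-monic zero    = monic-shift suc (hankel-suc s) (E-monic 0)
      (span-monic (ℕ.n<1+n _) (E-monic 0) (- c) (null {g = λ _ → 0ℚ} (λ _ → refl)) (λ _ → refl))
      λ j → trans (solve 4 (λ o a c e → o := (con 1ℚ :* o :+ :- (con 0ℚ :* con 0ℚ) :* o :+ (c :* e :+ con 0ℚ :* e)) :+ (con 0ℚ :+ :- c :* e)) refl
        (O 0 j) 0ℚ c (E 0 j)) (cong (_+ (0ℚ + - c * E 0 j)) (sym (E-next 0 j)))
    O-monic (suc m) = monic-shift suc (hankel-suc s) (E-monic (suc m))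
      (span-monic (ℕ.n<1+n _) (E-monic (suc m)) (- c)
        (span-monic (ℕ.m<n⇒m<1+n (ℕ.n<1+n _)) (O-monic m) (M * M) (null {g = λ _ → 0ℚ} (λ _ → refl)) (λ _ → refl)) (λ _ → refl))
      λ j → trans (solve 5 (λ o a o′ c e → o := (con 1ℚ :* o :+ :- a :* o′ :+ (c :* e :+ con 0ℚ :* e)) :+ ((con 0ℚ :+ a :* o′) :+ :- c :* e)) refl
        (O (suc m) j) (M * M) (O m j) c (E (suc m) j)) (cong (_+ (0ℚ + M * M * O m j + - c * E (suc m) j)) (sym (E-next (suc m) j)))
      where
      M : ℚ
      M = ι (suc m)

  diagonal : ℕ → ℚ
  diagonal m = E m (m ℕ.* 2)

  diagonal-suc : ∀ m → diagonal (suc m) ≡ ι (suc m) * ι (suc m) * A m * diagonal m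
  diagonal-suc m = trans (E-diagonal m) (trans (cong (- (ι (suc m) * ι (suc m)) *_) (O-diagonal m))
    (solve 3 (λ a b c → :- a :* (:- b :* c) := a :* b :* c) refl (ι (suc m) * ι (suc m)) (A m) (diagonal m)))

  block-diagonal : ∀ m → block E O m ≡ - A m * diagonal m * diagonal m
  block-diagonal m = trans
    (cong₂ (λ a b → E m (m ℕ.* 2) * a - E m (suc (m ℕ.* 2)) * b) (O-diagonal m) (proj₂ (vanishing (m ℕ.* 2)) m (ℕ.n<1+n _)))
    (solve 3 (λ e a b → e :* (:- a :* e) :- b :* con 0ℚ := :- a :* e :* e) refl (diagonal m) (A m) (E m (suc (m ℕ.* 2))))

  H-even : ∀ m → H (m ℕ.* 2) (λ k → T k s) ≡ ∏< (block E O) m * diagonal m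
  H-even m = trans (H≡Det (m ℕ.* 2) s) (trans
    (sym (Det-monic-rows (interleave-elim (Monic (hankel s)) E-monic O-monic) toℕ))
    (Det-interleave-odd m E-vanishing O-vanishing))

  H-odd : ∀ m → H (suc (m ℕ.* 2)) (λ k → T k s) ≡ ∏< (block E O) (suc m)
  H-odd m = trans (H≡Det (suc (m ℕ.* 2)) s) (trans
    (sym (Det-monic-rows (interleave-elim (Monic (hankel s)) E-monic O-monic) toℕ))
    (Det-interleave-even (suc m) E-vanishing O-vanishing))

  F : ℕ → ℚ
  F m = ι (m !)

  F-suc : ∀ m → F (suc m) ≡ ι (suc m) * F m
  F-suc m = ι-* (suc m) (m !)

  s²-odd² : ∀ i → (ι s ^ 2) - (ι (2 ℕ.* i ℕ.+ 1) ^ 2) ≡ - (ι 4 * A i)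
  s²-odd² i = trans
    (cong₂ (λ x y → (x ^ 2) - (y ^ 2)) ι-s (trans (ι-+ (2 ℕ.* i) 1) (cong (_+ 1ℚ) (ι-* 2 i))))
    (solve 2 (λ r i → (r :+ r :+ con 1ℚ) :* ((r :+ r :+ con 1ℚ) :* con 1ℚ) :- (con (ι 2) :* i :+ con 1ℚ) :* ((con (ι 2) :* i :+ con 1ℚ) :* con 1ℚ)
        := :- (con (ι 4) :* (i :* (i :+ con 1ℚ :+ con 0ℚ) :- r :* (r :+ con 1ℚ)))) refl (ι r) (ι i))

  -- Up to sign, `x (suc i)` is the multiplier from `diagonal i` to `diagonal (suc i)`.
  x : ℕ → ℚ
  x ℓ = ((+ (ℓ ℕ.^ 2)) / 4) * ((ι s ^ 2) - ((ι (2 ℕ.* ℓ) - 1ℚ) ^ 2))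

  x-suc : ∀ i → x (suc i) ≡ - (ι (suc i) * ι (suc i) * A i)
  x-suc i = begin
    ((+ (suc i ℕ.^ 2)) / 4) * ((ι s ^ 2) - ((ι (2 ℕ.* suc i) - 1ℚ) ^ 2))
      ≡⟨ cong (λ y → ((+ (suc i ℕ.^ 2)) / 4) * ((ι s ^ 2) - (y ^ 2))) 2ℓ-1 ⟩
    ((+ (suc i ℕ.^ 2)) / 4) * ((ι s ^ 2) - (ι (2 ℕ.* i ℕ.+ 1) ^ 2))
      ≡⟨ cong (((+ (suc i ℕ.^ 2)) / 4) *_) (s²-odd² i) ⟩
    ((+ (suc i ℕ.^ 2)) / 4) * - (ι 4 * A i)
      ≡⟨ solve 3 (λ q f a → q :* :- (f :* a) := :- (q :* f :* a)) refl ((+ (suc i ℕ.^ 2)) / 4) (ι 4) (A i) ⟩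
    - (((+ (suc i ℕ.^ 2)) / 4) * ι 4 * A i)
      ≡⟨ cong (λ y → - (y * A i)) (/-*-ι (+ (suc i ℕ.^ 2)) 4) ⟩
    - (ι (suc i ℕ.^ 2) * A i)
      ≡⟨ cong (λ y → - (y * A i)) (trans (ι-^ (suc i) 2) (cong (ι (suc i) *_) (ℚ.*-identityʳ (ι (suc i))))) ⟩
    - (ι (suc i) * ι (suc i) * A i) ∎
    where
    2ℓ-1 : ι (2 ℕ.* suc i) - 1ℚ ≡ ι (2 ℕ.* i ℕ.+ 1)
    2ℓ-1 = begin
      ι (2 ℕ.* suc i) - 1ℚ       ≡⟨ cong (_- 1ℚ) (trans (ι-* 2 (suc i)) (cong (ι 2 *_) (ι-suc i))) ⟩
      ι 2 * (ι i + 1ℚ) - 1ℚ      ≡⟨ solve 1 (λ i → con (ι 2) :* (i :+ con 1ℚ) :- con 1ℚ := con (ι 2) :* i :+ con 1ℚ) refl (ι i) ⟩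
      ι 2 * ι i + 1ℚ             ≡⟨ cong (_+ 1ℚ) (sym (ι-* 2 i)) ⟩
      ι (2 ℕ.* i) + 1ℚ           ≡⟨ sym (ι-+ (2 ℕ.* i) 1) ⟩
      ι (2 ℕ.* i ℕ.+ 1)          ∎

  diagonal² : ∀ m → diagonal m * diagonal m ≡ ∏< (λ i → x (suc i)) m * ∏< (λ i → x (suc i)) m
  diagonal² zero    = cong₂ _*_ E-zero-start E-zero-start
  diagonal² (suc m) = trans (cong (λ g → g * g) (diagonal-suc m)) (trans
    (solve 3 (λ l a g → l :* l :* a :* g :* (l :* l :* a :* g) := g :* g :* (:- (l :* l :* a) :* :- (l :* l :* a))) refl
      (ι (suc m)) (A m) (diagonal m))
    (trans (cong₂ (λ g y → g * (y * y)) (diagonal² m) (sym (x-suc m)))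
      (solve 2 (λ p y → p :* p :* (y :* y) := p :* y :* (p :* y)) refl (∏< (λ i → x (suc i)) m) (x (suc m)))))

  diagonal-factorial : ∀ m → diagonal m ≡ F m * F m * ∏< A m
  diagonal-factorial zero    = E-zero-start
  diagonal-factorial (suc m) = trans (diagonal-suc m) (trans (cong (ι (suc m) * ι (suc m) * A m *_) (diagonal-factorial m))
    (trans (solve 4 (λ l a f p → l :* l :* a :* (f :* f :* p) := l :* f :* (l :* f) :* (p :* a)) refl (ι (suc m)) (A m) (F m) (∏< A m))
      (cong (λ f → f * f * (∏< A m * A m)) (sym (F-suc m)))))

  -- A step from `m` to `suc m` multiplies the power product by `diagonal (suc m)` squared and the
  -- determinant by `- A m * diagonal m * diagonal (suc m)`. The two differ by the factor -(m + 1)²,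
  -- whence the sign and the factorials; placed on this side, they avoid division.
  evenPowers-H : ∀ m → evenPowers (λ i → x (suc i)) m
    ≡ (- 1ℚ) ^ m * (F m * F m) * (∏< (block E O) m * diagonal m)
  evenPowers-H zero    = sym (cong (λ d → 1ℚ * (F 0 * F 0) * (1ℚ * d)) E-zero-start)
  evenPowers-H (suc m) = begin
    evenPowers (λ i → x (suc i)) (suc m)
      ≡⟨ evenPowers-suc (λ i → x (suc i)) m ⟩
    evenPowers (λ i → x (suc i)) m * (∏< (λ i → x (suc i)) (suc m) * ∏< (λ i → x (suc i)) (suc m))
      ≡⟨ cong₂ _*_ (evenPowers-H m) (trans (sym (diagonal² (suc m))) (cong (_* diagonal (suc m)) (diagonal-suc m))) ⟩
    p * (F m * F m) * (B * diagonal m) * (L * L * A m * diagonal m * diagonal (suc m))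
      ≡⟨ solve 7 (λ p f b d l a d′ → p :* (f :* f) :* (b :* d) :* (l :* l :* a :* d :* d′)
           := (:- con 1ℚ) :* p :* (l :* f :* (l :* f)) :* (b :* (:- a :* d :* d) :* d′)) refl
           p (F m) B (diagonal m) L (A m) (diagonal (suc m)) ⟩
    - 1ℚ * p * (L * F m * (L * F m)) * (B * (- A m * diagonal m * diagonal m) * diagonal (suc m))
      ≡⟨ cong₂ (λ f b → - 1ℚ * p * (f * f) * (B * b * diagonal (suc m))) (sym (F-suc m)) (sym (block-diagonal m)) ⟩
    (- 1ℚ) ^ suc m * (F (suc m) * F (suc m)) * (∏< (block E O) (suc m) * diagonal (suc m)) ∎
    where
    p B L : ℚ
    p = (- 1ℚ) ^ m
    B = ∏< (block E O) m
    L = ι (suc m)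

  H-even-product : ∀ m .{{_ : ℕ.NonZero ((m !) ℕ.^ 2)}} → H (2 ℕ.* m) (λ k → T k s)
    ≡ ((-1ℤ ℤ.^ m) / ((m !) ℕ.^ 2)) * ∏[ ℓ ∈ 1 ⋯ m ] (x ℓ ^ (2 ℕ.* ((m ℕ.+ 1) ∸ ℓ)))
  H-even-product m = trans (H-2* m (λ k → T k s)) (trans (H-even m) (sym (begin
    a * ∏[ ℓ ∈ 1 ⋯ m ] (x ℓ ^ (2 ℕ.* ((m ℕ.+ 1) ∸ ℓ)))
      ≡⟨ cong (a *_) (trans (∏≡evenPowers x m) (evenPowers-H m)) ⟩
    a * (p * (F m * F m) * h)
      ≡⟨ solve 4 (λ a p f h → a :* (p :* (f :* f) :* h) := a :* (f :* (f :* con 1ℚ)) :* p :* h) refl a p (F m) h ⟩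
    a * F m ^ 2 * p * h
      ≡⟨ cong (λ f → a * f * p * h) (sym (ι-^ (m !) 2)) ⟩
    a * ι ((m !) ℕ.^ 2) * p * h
      ≡⟨ cong (λ f → f * p * h) (trans (/-*-ι (-1ℤ ℤ.^ m) ((m !) ℕ.^ 2)) (-1^/1 m)) ⟩
    p * p * h
      ≡⟨ trans (cong (_* h) (-1^n*-1^n m)) (ℚ.*-identityˡ h) ⟩
    h ∎)))
    where
    a p h : ℚ
    a = (-1ℤ ℤ.^ m) / ((m !) ℕ.^ 2)
    p = (- 1ℚ) ^ m
    h = ∏< (block E O) m * diagonal m

  q : ℕ → ℚ
  q ℓ = ((+ ((ℓ !) ℕ.^ 4)) / (16 ℕ.^ ℓ)) {{m^n≢0 16 ℓ}}

  q-16^ : ∀ ℓ → q ℓ * ι (16 ℕ.^ ℓ) ≡ F ℓ * F ℓ * (F ℓ * F ℓ)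
  q-16^ ℓ = trans (/-*-ι (+ ((ℓ !) ℕ.^ 4)) (16 ℕ.^ ℓ) {{m^n≢0 16 ℓ}}) (trans (ι-^ (ℓ !) 4)
    (solve 1 (λ f → f :* (f :* (f :* (f :* con 1ℚ))) := f :* f :* (f :* f)) refl (F ℓ)))

  f : ℕ → ℚ
  f ℓ = (ι s ^ 2) - (ι (2 ℕ.* ℓ ℕ.+ 1) ^ 2)

  ∏f² : ∀ n → ∏< f n * ∏< f n ≡ ι (16 ℕ.^ n) * (∏< A n * ∏< A n)
  ∏f² zero    = refl
  ∏f² (suc n) = begin
    ∏< f n * f n * (∏< f n * f n)
      ≡⟨ solve 2 (λ p y → p :* y :* (p :* y) := p :* p :* (y :* y)) refl (∏< f n) (f n) ⟩
    ∏< f n * ∏< f n * (f n * f n)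
      ≡⟨ cong₂ (λ p y → p * (y * y)) (∏f² n) (s²-odd² n) ⟩
    ι (16 ℕ.^ n) * (∏< A n * ∏< A n) * (- (ι 4 * A n) * - (ι 4 * A n))
      ≡⟨ solve 3 (λ c p a → c :* (p :* p) :* (:- (con (ι 4) :* a) :* :- (con (ι 4) :* a)) := con (ι 16) :* c :* (p :* a :* (p :* a))) refl
           (ι (16 ℕ.^ n)) (∏< A n) (A n) ⟩
    ι 16 * ι (16 ℕ.^ n) * (∏< A n * A n * (∏< A n * A n))
      ≡⟨ cong (_* (∏< A n * A n * (∏< A n * A n))) (sym (ι-* 16 (16 ℕ.^ n))) ⟩
    ι (16 ℕ.^ suc n) * (∏< A (suc n) * ∏< A (suc n)) ∎

  -- Each `f i` is -4 `A i`, so the square produces 16ⁿ, exactly the denominator of `q n`; the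
  -- numerator supplies the factorials of the diagonal.
  ∏f²q : ∀ n → ∏< f n * ∏< f n * q n ≡ diagonal n * diagonal n
  ∏f²q n = begin
    ∏< f n * ∏< f n * q n
      ≡⟨ cong (_* q n) (∏f² n) ⟩
    ι (16 ℕ.^ n) * (∏< A n * ∏< A n) * q n
      ≡⟨ solve 3 (λ c p q → c :* (p :* p) :* q := q :* c :* (p :* p)) refl (ι (16 ℕ.^ n)) (∏< A n) (q n) ⟩
    q n * ι (16 ℕ.^ n) * (∏< A n * ∏< A n)
      ≡⟨ cong (_* (∏< A n * ∏< A n)) (q-16^ n) ⟩
    F n * F n * (F n * F n) * (∏< A n * ∏< A n)
      ≡⟨ solve 2 (λ f p → f :* f :* (f :* f) :* (p :* p) := f :* f :* p :* (f :* f :* p)) refl (F n) (∏< A n) ⟩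
    F n * F n * ∏< A n * (F n * F n * ∏< A n)
      ≡⟨ sym (cong₂ _*_ (diagonal-factorial n) (diagonal-factorial n)) ⟩
    diagonal n * diagonal n ∎

  oddPowers-H : ∀ m → oddPowers q f m ≡ ι (4 ℕ.^ suc m) * ∏< (block E O) (suc m)
  oddPowers-H zero    = begin
    1ℚ * (q 0 * (f 0 * 1ℚ))
      ≡⟨ solve 2 (λ q f → con 1ℚ :* (q :* (f :* con 1ℚ)) := con 1ℚ :* con 1ℚ :* q :* f) refl (q 0) (f 0) ⟩
    1ℚ * 1ℚ * q 0 * f 0
      ≡⟨ cong₂ _*_ (∏f²q 0) (s²-odd² 0) ⟩
    diagonal 0 * diagonal 0 * - (ι 4 * A 0)
      ≡⟨ solve 2 (λ d a → d :* d :* :- (con (ι 4) :* a) := con (ι 4) :* (con 1ℚ :* (:- a :* d :* d))) refl (diagonal 0) (A 0) ⟩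
    ι 4 * (1ℚ * (- A 0 * diagonal 0 * diagonal 0))
      ≡⟨ cong (λ b → ι 4 * (1ℚ * b)) (sym (block-diagonal 0)) ⟩
    ι 4 * (1ℚ * block E O 0) ∎
  oddPowers-H (suc m) = begin
    oddPowers q f (suc m)
      ≡⟨ oddPowers-suc q f m ⟩
    oddPowers q f m * (∏< f (suc m) * ∏< f (suc m)) * (q (suc m) * f (suc m))
      ≡⟨ solve 4 (λ v p q f → v :* (p :* p) :* (q :* f) := v :* (p :* p :* q :* f)) refl (oddPowers q f m) (∏< f (suc m)) (q (suc m)) (f (suc m)) ⟩
    oddPowers q f m * (∏< f (suc m) * ∏< f (suc m) * q (suc m) * f (suc m))
      ≡⟨ cong₂ _*_ (oddPowers-H m) (cong₂ _*_ (∏f²q (suc m)) (s²-odd² (suc m))) ⟩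
    ι (4 ℕ.^ suc m) * K * (δ * δ * - (ι 4 * A (suc m)))
      ≡⟨ solve 4 (λ c k d a → c :* k :* (d :* d :* :- (con (ι 4) :* a)) := con (ι 4) :* c :* (k :* (:- a :* d :* d))) refl
           (ι (4 ℕ.^ suc m)) K δ (A (suc m)) ⟩
    ι 4 * ι (4 ℕ.^ suc m) * (K * (- A (suc m) * δ * δ))
      ≡⟨ cong₂ (λ c b → c * (K * b)) (sym (ι-* 4 (4 ℕ.^ suc m))) (sym (block-diagonal (suc m))) ⟩
    ι (4 ℕ.^ suc (suc m)) * ∏< (block E O) (suc (suc m)) ∎
    where
    K δ : ℚ
    K = ∏< (block E O) (suc m)
    δ = diagonal (suc m)

  H-odd-product : ∀ m .{{_ : ℕ.NonZero (4 ℕ.^ (m ℕ.+ 1))}} → H (2 ℕ.* m ℕ.+ 1) (λ k → T k s)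
    ≡ (1ℤ / (4 ℕ.^ (m ℕ.+ 1))) * ∏[ ℓ ∈ 0 ⋯ m ] (q ℓ * (f ℓ ^ (2 ℕ.* (m ∸ ℓ) ℕ.+ 1)))
  H-odd-product m = trans (H-2*+1 m (λ k → T k s)) (trans (H-odd m) (sym (begin
    a * ∏[ ℓ ∈ 0 ⋯ m ] (q ℓ * (f ℓ ^ (2 ℕ.* (m ∸ ℓ) ℕ.+ 1)))
      ≡⟨ cong (a *_) (trans (∏≡oddPowers q f m) (oddPowers-H m)) ⟩
    a * (ι (4 ℕ.^ suc m) * K)
      ≡⟨ sym (ℚ.*-assoc a (ι (4 ℕ.^ suc m)) K) ⟩
    a * ι (4 ℕ.^ suc m) * K
      ≡⟨ cong (λ n → a * ι (4 ℕ.^ n) * K) (ℕ.+-comm 1 m) ⟩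
    a * ι (4 ℕ.^ (m ℕ.+ 1)) * K
      ≡⟨ cong (_* K) (/-*-ι 1ℤ (4 ℕ.^ (m ℕ.+ 1))) ⟩
    1ℚ * K
      ≡⟨ ℚ.*-identityˡ K ⟩
    K ∎)))
    where
    a K : ℚ
    a = 1ℤ / (4 ℕ.^ (m ℕ.+ 1))
    K = ∏< (block E O) (suc m)

  -- `A r = 0` by the choice of σ. The first r + 1 blocks have total order s + 1, the first order
  -- exceeding the number of points. `H-odd` has one block more than `H-even`, hence the two bounds
  -- on `m`.
  block-zero : block E O r ≡ 0ℚ
  block-zero = trans (block-diagonal r)
    (solve 2 (λ r d → :- (r :* (r :+ con 1ℚ :+ con 0ℚ) :- r :* (r :+ con 1ℚ)) :* d :* d := con 0ℚ) refl (ι r) (diagonal r))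

  H-even-zero : ∀ m → m ≥ suc r → H (2 ℕ.* m) (λ k → T k s) ≡ 0ℚ
  H-even-zero m m>r = trans (H-2* m (λ k → T k s)) (trans (H-even m)
    (trans (cong (_* diagonal m) (∏<-zero (block E O) m>r block-zero)) (ℚ.*-zeroˡ (diagonal m))))

  H-odd-zero : ∀ m → m ≥ r → H (2 ℕ.* m ℕ.+ 1) (λ k → T k s) ≡ 0ℚ
  H-odd-zero m m≥r = trans (H-2*+1 m (λ k → T k s)) (trans (H-odd m) (∏<-zero (block E O) (ℕ.s≤s m≥r) block-zero))

-- The case s = 2t

module Even (t : ℕ) where

  s : ℕ
  s = t ℕ.* 2

  z : ℕ → ℚ
  z i = ι (suc i) - ι t

  -- The reflection is z ↦ 1 - z: it fixes v and negates the weight 2z - 1. The last argument -2t is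
  -- the functional at the weight itself, and σ turns `A k` into (k + 1)² - t².
  open Orthogonal s (λ i → z i + z i - 1ℚ) (λ i → z i * z i - z i) 1ℚ (ι t * ι t - 1ℚ) (- (ι t + ι t)) public

  -- An antidifference of (2 z - 1) e k for the alternating sum, up to a shift.
  G : ℕ → ℚ → ℚ
  G k z = z * ∏< (λ j → ι (suc j) * ι (suc j) - z * z) k

  -- Up to sign `G k` is the product of z - k, ..., z + k, and `e k` that of z - k, ..., z + k - 1,
  -- so one linear factor is left over. In `G-e′` the shift by one leaves a factor at the other end,
  -- and the two add up to the weight.
  G-e : ∀ k i → G k (z i) ≡ e k i * (z i + ι k)
  G-e zero    i = solve 1 (λ z → z :* con 1ℚ := con 1ℚ :* (z :+ con 0ℚ)) refl (z i)
  G-e (suc k) i = begin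
    z i * (F * (ι (suc k) * ι (suc k) - z i * z i))
      ≡⟨ solve 3 (λ z F K → z :* (F :* (K :* K :- z :* z)) := z :* F :* ((K :- z) :* (K :+ z))) refl (z i) F (ι (suc k)) ⟩
    G k (z i) * ((ι (suc k) - z i) * (ι (suc k) + z i))
      ≡⟨ cong₂ (λ a K → a * ((K - z i) * (K + z i))) (G-e k i) (ι-suc k) ⟩
    e k i * (z i + ι k) * ((ι k + 1ℚ - z i) * (ι k + 1ℚ + z i))
      ≡⟨ solve 3 (λ z e k → e :* (z :+ k) :* ((k :+ con 1ℚ :- z) :* (k :+ con 1ℚ :+ z))
           := e :* (k :* (k :+ con 1ℚ) :- (z :* z :- z)) :* (z :+ (k :+ con 1ℚ))) refl (z i) (e k i) (ι k) ⟩
    e (suc k) i * (z i + (ι k + 1ℚ))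
      ≡⟨ cong (λ K → e (suc k) i * (z i + K)) (sym (ι-suc k)) ⟩
    e (suc k) i * (z i + ι (suc k)) ∎
    where
    F : ℚ
    F = ∏< (λ j → ι (suc j) * ι (suc j) - z i * z i) k

  G-e′ : ∀ k i → G k (z i - 1ℚ) ≡ e k i * (z i - 1ℚ - ι k)
  G-e′ zero    i = solve 1 (λ z → (z :- con 1ℚ) :* con 1ℚ := con 1ℚ :* (z :- con 1ℚ :- con 0ℚ)) refl (z i)
  G-e′ (suc k) i = begin
    (z i - 1ℚ) * (F * (ι (suc k) * ι (suc k) - (z i - 1ℚ) * (z i - 1ℚ)))
      ≡⟨ solve 3 (λ z F K → (z :- con 1ℚ) :* (F :* (K :* K :- (z :- con 1ℚ) :* (z :- con 1ℚ)))
           := (z :- con 1ℚ) :* F :* ((K :- z :+ con 1ℚ) :* (K :+ z :- con 1ℚ))) refl (z i) F (ι (suc k)) ⟩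
    G k (z i - 1ℚ) * ((ι (suc k) - z i + 1ℚ) * (ι (suc k) + z i - 1ℚ))
      ≡⟨ cong₂ (λ a K → a * ((K - z i + 1ℚ) * (K + z i - 1ℚ))) (G-e′ k i) (ι-suc k) ⟩
    e k i * (z i - 1ℚ - ι k) * ((ι k + 1ℚ - z i + 1ℚ) * (ι k + 1ℚ + z i - 1ℚ))
      ≡⟨ solve 3 (λ z e k → e :* (z :- con 1ℚ :- k) :* ((k :+ con 1ℚ :- z :+ con 1ℚ) :* (k :+ con 1ℚ :+ z :- con 1ℚ))
           := e :* (k :* (k :+ con 1ℚ) :- (z :* z :- z)) :* (z :- con 1ℚ :- (k :+ con 1ℚ))) refl (z i) (e k i) (ι k) ⟩
    e (suc k) i * (z i - 1ℚ - (ι k + 1ℚ))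
      ≡⟨ cong (λ K → e (suc k) i * (z i - 1ℚ - K)) (sym (ι-suc k)) ⟩
    e (suc k) i * (z i - 1ℚ - ι (suc k)) ∎
    where
    F : ℚ
    F = ∏< (λ j → ι (suc j) * ι (suc j) - (z i - 1ℚ) * (z i - 1ℚ)) k

  e-antidifference : ∀ k i → (z i + z i - 1ℚ) * e k i ≡ G k (z i - 1ℚ) + G k (z (suc i) - 1ℚ)
  e-antidifference k i = sym (trans
    (cong₂ _+_ (G-e′ k i) (trans (cong (G k) (trans (cong (λ x → x - ι t - 1ℚ) (ι-suc (suc i)))
      (solve 2 (λ x t → x :+ con 1ℚ :- t :- con 1ℚ := x :- t) refl (ι (suc i)) (ι t)))) (G-e k i)))
    (solve 3 (λ z e k → e :* (z :- con 1ℚ :- k) :+ e :* (z :+ k) := (z :+ z :- con 1ℚ) :* e) refl (z i) (e k i) (ι k)))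

  A-square : ∀ k → A k ≡ ι (suc k) * ι (suc k) - ι t * ι t
  A-square k = trans
    (solve 2 (λ k t → k :* (k :+ con 1ℚ :+ con 1ℚ) :- (t :* t :- con 1ℚ) := (k :+ con 1ℚ) :* (k :+ con 1ℚ) :- t :* t) refl (ι k) (ι t))
    (cong (λ K → K * K - ι t * ι t) (sym (ι-suc k)))

  G-ends : ∀ k y → y * y ≡ ι t * ι t → G k y ≡ y * ∏< A k
  G-ends k y eq = cong (y *_) (products k)
    where
    products : ∀ k → ∏< (λ j → ι (suc j) * ι (suc j) - y * y) k ≡ ∏< A k
    products zero    = refl
    products (suc k) = cong₂ _*_ (products k) (trans (cong (λ w → ι (suc k) * ι (suc k) - w) eq) (sym (A-square k)))

  ι-s : ι s ≡ ι t + ι t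
  ι-s = trans (ι-* t 2) (solve 1 (λ t → t :* con (ι 2) := t :+ t) refl (ι t))

  N-e : ∀ k → N (e k) ≡ - (ι t + ι t) * ∏< A k
  N-e k = begin
    N (e k)
      ≡⟨ alt-cong s (λ i _ → e-antidifference k i) ⟩
    alt s (λ i → G k (z i - 1ℚ) + G k (z (suc i) - 1ℚ))
      ≡⟨ alt-telescope s (λ i → G k (z i - 1ℚ)) ⟩
    G k (z 0 - 1ℚ) - (- 1ℚ) ^ s * G k (z s - 1ℚ)
      ≡⟨ cong₂ _-_
           (trans (cong (G k) (solve 1 (λ t → con 1ℚ :- t :- con 1ℚ := :- t) refl (ι t)))
             (G-ends k (- ι t) (solve 1 (λ t → :- t :* :- t := t :* t) refl (ι t))))
           (cong₂ _*_ (-1^[n*2] t)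
             (trans (cong (G k) (trans (cong (λ x → x - ι t - 1ℚ) (trans (ι-suc s) (cong (_+ 1ℚ) ι-s)))
               (solve 1 (λ t → t :+ t :+ con 1ℚ :- t :- con 1ℚ := t) refl (ι t)))) (G-ends k (ι t) refl))) ⟩
    - ι t * ∏< A k - 1ℚ * (ι t * ∏< A k)
      ≡⟨ solve 2 (λ t F → :- t :* F :- con 1ℚ :* (t :* F) := :- (t :+ t) :* F) refl (ι t) (∏< A k) ⟩
    - (ι t + ι t) * ∏< A k ∎

  E O : ℕ → ℕ → ℚ
  E m = moment s (P m)
  O m = moment s (λ i → z i * P m i)

  z-reflect : ∀ {i} → i ℕ.< s → z (s ∸ suc i) ≡ 1ℚ - z i
  z-reflect {i} i<s = trans (cong (_- ι t) (trans (ι-reflect i<s) (cong (λ w → w + 1ℚ - ι (suc i)) ι-s)))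
    (solve 2 (λ t x → t :+ t :+ con 1ℚ :- x :- t := con 1ℚ :- (x :- t)) refl (ι t) (ι (suc i)))

  E-start : ∀ m → E m 0 ≡ 0ℚ
  E-start m = alt-skew s _ λ i i<s → trans
    (cong (_* 1ℚ) (P-cong m (trans (cong (λ w → w * w - w) (z-reflect i<s))
      (solve 1 (λ z → (con 1ℚ :- z) :* (con 1ℚ :- z) :- (con 1ℚ :- z) := z :* z :- z) refl (z i)))))
    (trans (sym (ℚ.*-identityˡ (P m i * 1ℚ))) (cong (_* (P m i * 1ℚ)) (sym (-1^[n*2] t))))

  -- Write z as half of 2z - 1 plus one half: the first part is the weight of `N`, and the second
  -- gives `E m 0`, which the reflection kills.
  O-start : ∀ m → O m 0 ≡ ½ * N (P m)
  O-start m = begin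
    O m 0
      ≡⟨ alt-cong s (λ i _ → solve 2 (λ z p → z :* p :* con 1ℚ := con ½ :* ((z :+ z :- con 1ℚ) :* p) :+ con ½ :* (p :* con 1ℚ)) refl (z i) (P m i)) ⟩
    alt s (λ i → ½ * ((z i + z i - 1ℚ) * P m i) + ½ * (P m i * 1ℚ))
      ≡⟨ alt-linear s ½ (λ i → (z i + z i - 1ℚ) * P m i) ½ (λ i → P m i * 1ℚ) ⟩
    ½ * N (P m) + ½ * E m 0
      ≡⟨ cong (λ w → ½ * N (P m) + ½ * w) (E-start m) ⟩
    ½ * N (P m) + ½ * 0ℚ
      ≡⟨ solve 1 (λ n → n :+ con ½ :* con 0ℚ := n) refl (½ * N (P m)) ⟩
    ½ * N (P m) ∎

  O-zero-start : O 0 0 ≡ - ι t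
  O-zero-start = trans (O-start 0) (trans (cong (½ *_) (N-P-zero N-e))
    (solve 1 (λ t → con ½ :* :- (t :+ t) := :- t) refl (ι t)))

  O-suc-start : ∀ m → O (suc m) 0 ≡ 0ℚ
  O-suc-start m = trans (O-start (suc m)) (cong (½ *_) (N-P-suc N-e m))

  E-next : ∀ m j → E m (suc j) ≡ 0ℚ * E m j + 1ℚ * O m j + (ι t * E m j + 0ℚ * E m j)
  E-next m j = trans (moment-suc s (P m) j) (moment-linear s j
    0ℚ (P m) 1ℚ (λ i → z i * P m i) (ι t) (P m) 0ℚ (P m) λ i →
    solve 3 (λ x t p → x :* p := con 0ℚ :* p :+ con 1ℚ :* ((x :- t) :* p) :+ (t :* p :+ con 0ℚ :* p)) refl (ι (suc i)) (ι t) (P m i))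

  B : ℕ → ℚ
  B m = ι m * ι m * A (ℕ.pred m)

  -- From x z = v + (1 + t) z and the three-term recurrence for v `P m`.
  O-next : ∀ m j → O m (suc j) ≡
    1ℚ * E (suc m) j + B m * E (ℕ.pred m) j + (- (A m + ι m * ι m) * E m j + (1ℚ + ι t) * O m j)
  O-next m j = trans (moment-suc s (λ i → z i * P m i) j) (moment-linear s j
    1ℚ (P (suc m)) (B m) (P (ℕ.pred m)) (- (A m + ι m * ι m)) (P m) (1ℚ + ι t) (λ i → z i * P m i) λ i → begin
    ι (suc i) * (z i * P m i)
      ≡⟨ solve 3 (λ x t p → x :* ((x :- t) :* p) := ((x :- t) :* (x :- t) :- (x :- t)) :* p :+ (con 1ℚ :+ t) :* ((x :- t) :* p)) refl
           (ι (suc i)) (ι t) (P m i) ⟩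
    (z i * z i - z i) * P m i + (1ℚ + ι t) * (z i * P m i)
      ≡⟨ cong (_+ (1ℚ + ι t) * (z i * P m i)) (vP-by-P m i) ⟩
    P (suc m) i - (A m + ι m * ι m) * P m i + B m * P (ℕ.pred m) i + (1ℚ + ι t) * (z i * P m i)
      ≡⟨ solve 6 (λ p a p′ b p″ c → p :- a :* p′ :+ b :* p″ :+ c := con 1ℚ :* p :+ b :* p″ :+ (:- a :* p′ :+ c)) refl
           (P (suc m) i) (A m + ι m * ι m) (P m i) (B m) (P (ℕ.pred m) i) ((1ℚ + ι t) * (z i * P m i)) ⟩
    1ℚ * P (suc m) i + B m * P (ℕ.pred m) i + (- (A m + ι m * ι m) * P m i + (1ℚ + ι t) * (z i * P m i)) ∎)

  -- Compared with s odd the roles are exchanged: the reflection now kills the first column of `E`,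
  -- so the additional zero falls on the diagonal position of the `E` rows and forces blocks.
  vanishing : ∀ j → (∀ m → j ℕ.< suc (m ℕ.* 2) → E m j ≡ 0ℚ) × (∀ m → j ℕ.< m ℕ.* 2 → O m j ≡ 0ℚ)
  vanishing zero = (λ m _ → E-start m) , λ { (suc m) _ → O-suc-start m }
  vanishing (suc j) = E-vanish , O-vanish
    where
    E-vanish : ∀ m → suc j ℕ.< suc (m ℕ.* 2) → E m (suc j) ≡ 0ℚ
    E-vanish m (ℕ.s≤s j<) = trans (E-next m j) (combination≡0 0ℚ 1ℚ (ι t) 0ℚ
      Emj (proj₂ (vanishing j) m j<) Emj Emj)
      where
      Emj : E m j ≡ 0ℚ
      Emj = proj₁ (vanishing j) m (ℕ.m<n⇒m<1+n j<)
    O-vanish : ∀ m → suc j ℕ.< m ℕ.* 2 → O m (suc j) ≡ 0ℚ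
    O-vanish (suc m) (ℕ.s≤s j<) = trans (O-next (suc m) j)
      (combination≡0 1ℚ (B (suc m)) (- (A (suc m) + ι (suc m) * ι (suc m))) (1ℚ + ι t)
      (proj₁ (vanishing j) (suc (suc m)) (ℕ.m<n⇒m<1+n (ℕ.m<n⇒m<1+n (ℕ.m<n⇒m<1+n (ℕ.m<n⇒m<1+n j<)))))
      (proj₁ (vanishing j) m j<)
      (proj₁ (vanishing j) (suc m) (ℕ.m<n⇒m<1+n (ℕ.m<n⇒m<1+n j<)))
      (proj₂ (vanishing j) (suc m) (ℕ.m<n⇒m<1+n j<)))

  E-vanishing : Vanishing E
  E-vanishing m j j< = proj₁ (vanishing j) m (ℕ.m<n⇒m<1+n j<)

  O-vanishing : Vanishing O
  O-vanishing m j = proj₂ (vanishing j) m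

  diagonal : ℕ → ℚ
  diagonal m = O m (m ℕ.* 2)

  E-central : ∀ m → E m (m ℕ.* 2) ≡ 0ℚ
  E-central m = proj₁ (vanishing (m ℕ.* 2)) m (ℕ.n<1+n _)

  -- Since x = z + t, and `E m` vanishes one column earlier, the two antidiagonal entries of a block
  -- agree.
  E-diagonal : ∀ m → E m (suc (m ℕ.* 2)) ≡ diagonal m
  E-diagonal m = trans (E-next m (m ℕ.* 2))
    (trans (only-second 0ℚ 1ℚ (ι t) 0ℚ {y = diagonal m} (E-central m) (E-central m) (E-central m)) (ℚ.*-identityˡ (diagonal m)))

  diagonal-suc : ∀ m → diagonal (suc m) ≡ ι (suc m) * ι (suc m) * A m * diagonal m
  diagonal-suc m = trans (O-next (suc m) (suc (m ℕ.* 2))) (trans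
    (only-second 1ℚ (B (suc m)) (- (A (suc m) + ι (suc m) * ι (suc m))) (1ℚ + ι t) {y = E m (suc (m ℕ.* 2))}
      (E-vanishing (suc (suc m)) (suc (m ℕ.* 2)) (ℕ.m<n⇒m<1+n (ℕ.m<n⇒m<1+n (ℕ.n<1+n _))))
      (E-vanishing (suc m) (suc (m ℕ.* 2)) (ℕ.n<1+n _)) (O-vanishing (suc m) (suc (m ℕ.* 2)) (ℕ.n<1+n _)))
    (cong (B (suc m) *_) (E-diagonal m)))

  block-diagonal : ∀ m → block E O m ≡ - (diagonal m * diagonal m)
  block-diagonal m = trans
    (cong₂ (λ a b → a * O m (suc (m ℕ.* 2)) - b * diagonal m) (E-central m) (E-diagonal m))
    (solve 2 (λ a g → con 0ℚ :* a :- g :* g := :- (g :* g)) refl (O m (suc (m ℕ.* 2))) (diagonal m))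

  mutual
    E-monic : ∀ m → Monic (hankel s) (m ℕ.* 2) (E m)
    E-monic zero    = (λ _ → 0ℚ) , null (λ _ → refl) , λ j → sym (ℚ.+-identityˡ (E 0 j))
    -- The term with `B 0` points to `E (ℕ.pred 0)`, that is `E 0`, and carries the coefficient
    -- zero, so it is absent from the lower terms.
    E-monic (suc zero) = monic-shift suc (hankel-suc s) (O-monic 0)
      (span-monic (ℕ.n<1+n _) (O-monic 0) (- (1ℚ + ι t))
        (span-monic (ℕ.m<n⇒m<1+n (ℕ.n<1+n _)) (E-monic 0) (A 0 + ι 0 * ι 0) (null {g = λ _ → 0ℚ} (λ _ → refl)) (λ _ → refl)) (λ _ → refl))
      λ j → trans (solve 6 (λ e b e₀ a c o → e := (con 1ℚ :* e :+ con 0ℚ :* con 0ℚ :* b :* e₀ :+ (:- a :* e₀ :+ c :* o)) :+ ((con 0ℚ :+ a :* e₀) :+ :- c :* o)) refl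
        (E 1 j) (A 0) (E 0 j) (A 0 + ι 0 * ι 0) (1ℚ + ι t) (O 0 j))
        (cong (_+ (0ℚ + (A 0 + ι 0 * ι 0) * E 0 j + - (1ℚ + ι t) * O 0 j)) (sym (O-next 0 j)))
    E-monic (suc m@(suc m-1)) = monic-shift suc (hankel-suc s) (O-monic m)
      (span-monic (ℕ.n<1+n _) (O-monic m) (- (1ℚ + ι t))
        (span-monic (ℕ.m<n⇒m<1+n (ℕ.n<1+n _)) (E-monic m) (A m + ι m * ι m)
          (span-monic (ℕ.m<n⇒m<1+n (ℕ.m<n⇒m<1+n (ℕ.m<n⇒m<1+n (ℕ.n<1+n _)))) (E-monic m-1) (- B m)
            (null {g = λ _ → 0ℚ} (λ _ → refl)) (λ _ → refl)) (λ _ → refl)) (λ _ → refl))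
      λ j → trans (solve 7 (λ e b e₀ a e₁ c o →
          e := (con 1ℚ :* e :+ b :* e₀ :+ (:- a :* e₁ :+ c :* o)) :+ (con 0ℚ :+ :- b :* e₀ :+ a :* e₁ :+ :- c :* o)) refl
        (E (suc m) j) (B m) (E m-1 j) (A m + ι m * ι m) (E m j) (1ℚ + ι t) (O m j))
        (cong (_+ (0ℚ + - B m * E m-1 j + (A m + ι m * ι m) * E m j + - (1ℚ + ι t) * O m j)) (sym (O-next m j)))

    O-monic : ∀ m → Monic (hankel s) (suc (m ℕ.* 2)) (O m)
    O-monic m = monic-shift suc (hankel-suc s) (E-monic m)
      (span-monic (ℕ.n<1+n _) (E-monic m) (- ι t) (null {g = λ _ → 0ℚ} (λ _ → refl)) (λ _ → refl))
      λ j → trans (solve 3 (λ o t e → o := (con 0ℚ :* e :+ con 1ℚ :* o :+ (t :* e :+ con 0ℚ :* e)) :+ (con 0ℚ :+ :- t :* e)) refl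
        (O m j) (ι t) (E m j)) (cong (_+ (0ℚ + - ι t * E m j)) (sym (E-next m j)))

  H-even : ∀ m → H (m ℕ.* 2) (λ k → T k s) ≡ 0ℚ
  H-even m = trans (H≡Det (m ℕ.* 2) s) (trans
    (sym (Det-monic-rows (interleave-elim (Monic (hankel s)) E-monic O-monic) toℕ))
    (trans (Det-interleave-odd m E-vanishing O-vanishing)
      (trans (cong (∏< (block E O) m *_) (E-central m)) (ℚ.*-zeroʳ (∏< (block E O) m)))))

  H-odd : ∀ m → H (suc (m ℕ.* 2)) (λ k → T k s) ≡ ∏< (block E O) (suc m)
  H-odd m = trans (H≡Det (suc (m ℕ.* 2)) s) (trans
    (sym (Det-monic-rows (interleave-elim (Monic (hankel s)) E-monic O-monic) toℕ))
    (Det-interleave-even (suc m) E-vanishing O-vanishing))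

  x : ℕ → ℚ
  x ℓ = (ι ℓ ^ 2) * ((ι t ^ 2) - (ι ℓ ^ 2))

  diagonal² : ∀ m → diagonal m * diagonal m ≡ ι t ^ 2 * (∏< (λ i → x (suc i)) m * ∏< (λ i → x (suc i)) m)
  diagonal² zero    = trans (cong₂ _*_ O-zero-start O-zero-start)
    (solve 1 (λ t → :- t :* :- t := t :* (t :* con 1ℚ) :* (con 1ℚ :* con 1ℚ)) refl (ι t))
  diagonal² (suc m) = begin
    diagonal (suc m) * diagonal (suc m)
      ≡⟨ cong (λ g → g * g) (trans (diagonal-suc m) (cong (λ a → L * L * a * diagonal m) (A-square m))) ⟩
    L * L * (L * L - ι t * ι t) * diagonal m * (L * L * (L * L - ι t * ι t) * diagonal m)
      ≡⟨ solve 3 (λ l a g → l :* l :* a :* g :* (l :* l :* a :* g) := g :* g :* (l :* l :* a :* (l :* l :* a))) refl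
           L (L * L - ι t * ι t) (diagonal m) ⟩
    diagonal m * diagonal m * (L * L * (L * L - ι t * ι t) * (L * L * (L * L - ι t * ι t)))
      ≡⟨ cong (_* (L * L * (L * L - ι t * ι t) * (L * L * (L * L - ι t * ι t)))) (diagonal² m) ⟩
    ι t ^ 2 * (X * X) * (L * L * (L * L - ι t * ι t) * (L * L * (L * L - ι t * ι t)))
      ≡⟨ solve 4 (λ c p l t → c :* (p :* p) :* (l :* l :* (l :* l :- t :* t) :* (l :* l :* (l :* l :- t :* t)))
           := c :* (p :* (l :* (l :* con 1ℚ) :* (t :* (t :* con 1ℚ) :- l :* (l :* con 1ℚ)))
                :* (p :* (l :* (l :* con 1ℚ) :* (t :* (t :* con 1ℚ) :- l :* (l :* con 1ℚ)))))) refl (ι t ^ 2) X L (ι t) ⟩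
    ι t ^ 2 * (∏< (λ i → x (suc i)) (suc m) * ∏< (λ i → x (suc i)) (suc m)) ∎
    where
    L X : ℚ
    L = ι (suc m)
    X = ∏< (λ i → x (suc i)) m

  -- A block is minus the square of a diagonal entry, and that entry is, up to sign, t times a
  -- partial product of the `x (suc i)`. Each block thus adds one factor -t² and one layer of
  -- `evenPowers`.
  ∏-block : ∀ m → ∏< (block E O) (suc m) ≡ (- (ι t ^ 2)) ^ suc m * evenPowers (λ i → x (suc i)) m
  ∏-block zero    = trans (cong (1ℚ *_) (trans (block-diagonal 0) (cong -_ (diagonal² 0))))
    (solve 1 (λ a → con 1ℚ :* :- (a :* (con 1ℚ :* con 1ℚ)) := :- a :* con 1ℚ :* con 1ℚ) refl (ι t ^ 2))
  ∏-block (suc m) = trans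
    (cong₂ _*_ (∏-block m) (trans (block-diagonal (suc m)) (cong -_ (diagonal² (suc m)))))
    (trans (solve 4 (λ p w a g → p :* w :* :- (a :* (g :* g)) := :- a :* p :* (w :* (g :* g))) refl
        ((- (ι t ^ 2)) ^ suc m) (evenPowers (λ i → x (suc i)) m) (ι t ^ 2) (∏< (λ i → x (suc i)) (suc m)))
      (cong ((- (ι t ^ 2)) ^ suc (suc m) *_) (sym (evenPowers-suc (λ i → x (suc i)) m))))

  H-odd-product : ∀ m → H (2 ℕ.* m ℕ.+ 1) (λ k → T k s)
    ≡ ((- (ι t ^ 2)) ^ (m ℕ.+ 1)) * ∏[ ℓ ∈ 1 ⋯ m ] (x ℓ ^ (2 ℕ.* ((m ℕ.+ 1) ∸ ℓ)))
  H-odd-product m = trans (H-2*+1 m (λ k → T k s)) (trans (H-odd m) (trans (∏-block m)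
    (cong₂ _*_ (sym (cong ((- (ι t ^ 2)) ^_) (ℕ.+-comm m 1))) (sym (∏≡evenPowers x m)))))

  diagonal-zero : ∀ n → t ≡ suc n → diagonal t ≡ 0ℚ
  diagonal-zero n t≡1+n = trans (cong diagonal t≡1+n) (trans (diagonal-suc n)
    (trans (cong (λ a → ι (suc n) * ι (suc n) * a * diagonal n) (trans (A-square n)
      (trans (cong (λ u → ι (suc n) * ι (suc n) - ι u * ι u) t≡1+n) (ℚ.+-inverseʳ (ι (suc n) * ι (suc n))))))
      (solve 2 (λ l g → l :* con 0ℚ :* g := con 0ℚ) refl (ι (suc n) * ι (suc n)) (diagonal n))))

  H-odd-zero : ∀ m → s ≥ 1 → m ≥ t → H (2 ℕ.* m ℕ.+ 1) (λ k → T k s) ≡ 0ℚ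
  H-odd-zero m s≥1 m≥t = trans (H-2*+1 m (λ k → T k s)) (trans (H-odd m)
    (∏<-zero (block E O) (ℕ.s≤s m≥t) (trans (block-diagonal t) (cong (λ g → - (g * g)) (vanish t refl s≥1)))))
    where
    -- The parameter `t` is fixed by the module, so a copy of it is split. The value 0 is excluded
    -- by s ≥ 1; otherwise `diagonal t` contains `A` at t - 1, which is t² - t².
    vanish : ∀ n → t ≡ n → n ℕ.* 2 ≥ 1 → diagonal t ≡ 0ℚ
    vanish (suc n) t≡1+n _ = diagonal-zero n t≡1+n

-- Both parities of s together

odd-form : ∀ s → s ℕ.% 2 ≡ 1 → ∃[ r ] s ≡ suc (r ℕ.* 2)
odd-form s s%2≡1 = s ℕ./ 2 , trans (m≡m%n+[m/n]*n s 2) (cong (ℕ._+ (s ℕ./ 2) ℕ.* 2) s%2≡1)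

corollary4p5 : (s : ℕ) → s ≥ 1 →
  (∀ t → s ≡ 2 ℕ.* t → ∀ m →
      H (2 ℕ.* m) (λ k → T k s) ≡ 0ℚ
    × H (2 ℕ.* m ℕ.+ 1) (λ k → T k s)
        ≡ ((- (ι t ^ 2)) ^ (m ℕ.+ 1))
          * ∏[ ℓ ∈ 1 ⋯ m ] (((ι ℓ ^ 2) * ((ι t ^ 2) - (ι ℓ ^ 2))) ^ (2 ℕ.* ((m ℕ.+ 1) ∸ ℓ)))
    × (m ≥ t → H (2 ℕ.* m ℕ.+ 1) (λ k → T k s) ≡ 0ℚ))
  ×
  (s ℕ.% 2 ≡ 1 → ∀ m →
      H (2 ℕ.* m) (λ k → T k s)
        ≡ (((-1ℤ ℤ.^ m) / ((m !) ℕ.^ 2)) {{m^n≢0 (m !) 2 {{m !≢0}}}})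
          * ∏[ ℓ ∈ 1 ⋯ m ] ((((+ (ℓ ℕ.^ 2)) / 4) * ((ι s ^ 2) - ((ι (2 ℕ.* ℓ) - 1ℚ) ^ 2))) ^ (2 ℕ.* ((m ℕ.+ 1) ∸ ℓ)))
    × H (2 ℕ.* m ℕ.+ 1) (λ k → T k s)
        ≡ ((1ℤ / (4 ℕ.^ (m ℕ.+ 1))) {{m^n≢0 4 (m ℕ.+ 1)}})
          * ∏[ ℓ ∈ 0 ⋯ m ] ((((+ ((ℓ !) ℕ.^ 4)) / (16 ℕ.^ ℓ)) {{m^n≢0 16 ℓ}}) * (((ι s ^ 2) - (ι (2 ℕ.* ℓ ℕ.+ 1) ^ 2)) ^ (2 ℕ.* (m ∸ ℓ) ℕ.+ 1)))
    × (m ≥ (s ℕ.+ 1) ℕ./ 2 → H (2 ℕ.* m) (λ k → T k s) ≡ 0ℚ)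
    × (m ≥ (s ∸ 1) ℕ./ 2 → H (2 ℕ.* m ℕ.+ 1) (λ k → T k s) ≡ 0ℚ))
corollary4p5 s s≥1 =
  (λ t s≡2t → case trans s≡2t (ℕ.*-comm 2 t) of λ { refl m →
    trans (H-2* m (λ k → T k s)) (Even.H-even t m) , Even.H-odd-product t m , Even.H-odd-zero t m s≥1 })
  , λ s%2≡1 → case odd-form s s%2≡1 of λ { (r , refl) m →
    Odd.H-even-product r m {{m^n≢0 (m !) 2 {{m !≢0}}}} , Odd.H-odd-product r m {{m^n≢0 4 (m ℕ.+ 1)}}
    , (λ m≥ → Odd.H-even-zero r m (subst (m ≥_) (trans (cong (ℕ._/ 2) (ℕ.+-comm s 1)) (m*n/n≡m (suc r) 2)) m≥))
    , (λ m≥ → Odd.H-odd-zero r m (subst (m ≥_) (m*n/n≡m r 2) m≥)) }
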